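{- Let $T$ be a punctual tree (viewed as a partial order) of finite height such that one of the following holds: (1) $T$ has at least two nodes each having infinitely many immediate successors; or (2) $T$ has exactly one node with infinitely many immediate successors, and each of these successors has an immediate successor of its own. Then $\mathrm{PrCat}(T)\subseteq\mathrm{Cone}(\Delta^0_1)$.
   Context: A tree is a partial order with a least element (the root) in which the set of predecessors of every node is a finite linear order; it has finite height if there is a finite bound on the lengths of chains. A node $b$ is an immediate successor of $a$ if $a<b$ and there is no $c$ with $a<c<b$. A structure is punctual if its domain is $\omega$ and its relations are uniformly primitive recursive. For total $f,g:\omega\to\omega$, write $f\le_{PR}g$ if $f$ is primitive recursive relative to $g$; the induced equivalence classes are PR-degrees, and $f\le_{PR}\mathbf d$ means $f\le_{PR}$ a member of $\mathbf d$. For a punctual structure $A$, $\mathrm{PrCat}(A)$ is the set of PR-degrees $\mathbf d$ such that for every punctual $B\cong A$ there is an isomorphism $f:A\to B$ with $f\le_{PR}\mathbf d$ and $f^{ -1}\le_{PR}\mathbf d$. $\mathrm{Cone}(\Delta^0_1)$ is the set of PR-degrees $\mathbf d$ such that $f\le_{PR}\mathbf d$ for every total computable function $f:\omega\to\omega$. -}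

module Defs where

open import Data.Nat using (ℕ; zero; suc; _≤_; _<_)
open import Data.Fin using (Fin)
open import Data.Vec using (Vec; []; _∷_; lookup; tabulate)
open import Data.Bool using (Bool; true; false; if_then_else_)
open import Data.List using (List; []; _∷_; length)
open import Data.List.Membership.Propositional using (_∈_)
open import Data.Product using (Σ; ∃; ∃-syntax; _×_; _,_)
open import Data.Sum using (_⊎_)
open import Relation.Nullary using (¬_)
open import Relation.Binary.PropositionalEquality using (_≡_; _≢_)

data PR : ℕ → Set where
  pzero : ∀ {n} → PR n
  psucc : PR 1
  pproj : ∀ {n} → Fin n → PR n
  porc  : PR 1
  pcomp : ∀ {m n} → PR m → (Fin m → PR n) → PR n
  prec  : ∀ {n} → PR n → PR (suc (suc n)) → PR (suc n)

mutual
  ⟦_⟧ : ∀ {n} → PR n → (ℕ → ℕ) → Vec ℕ n → ℕ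
  ⟦ pzero ⟧ g xs = 0
  ⟦ psucc ⟧ g (x ∷ []) = suc x
  ⟦ pproj i ⟧ g xs = lookup xs i
  ⟦ porc ⟧ g (x ∷ []) = g x
  ⟦ pcomp f hs ⟧ g xs = ⟦ f ⟧ g (tabulate (λ i → ⟦ hs i ⟧ g xs))
  ⟦ prec f h ⟧ g (k ∷ xs) = evalRec f h g k xs

  evalRec : ∀ {n} → PR n → PR (suc (suc n)) → (ℕ → ℕ) → ℕ → Vec ℕ n → ℕ
  evalRec f h g zero xs = ⟦ f ⟧ g xs
  evalRec f h g (suc k) xs = ⟦ h ⟧ g (k ∷ evalRec f h g k xs ∷ xs)

_≤PR_ : (ℕ → ℕ) → (ℕ → ℕ) → Set
f ≤PR g = Σ (PR 1) λ t → ∀ x → ⟦ t ⟧ g (x ∷ []) ≡ f x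

-- a binary relation (given by a Boolean characteristic function) is
-- primitive recursive (no oracle is used: the oracle is the zero function)
PrimRecRel : (ℕ → ℕ → Bool) → Set
PrimRecRel R = Σ (PR 2) λ t →
  ∀ x y → ⟦ t ⟧ (λ _ → 0) (x ∷ y ∷ []) ≡ (if R x y then 1 else 0)

data Rec : ℕ → Set where
  rzero : ∀ {n} → Rec n
  rsucc : Rec 1
  rproj : ∀ {n} → Fin n → Rec n
  rcomp : ∀ {m n} → Rec m → (Fin m → Rec n) → Rec n
  rrec  : ∀ {n} → Rec n → Rec (suc (suc n)) → Rec (suc n)
  rmu   : ∀ {n} → Rec (suc n) → Rec n

data Eval : ∀ {n} → Rec n → Vec ℕ n → ℕ → Set where
  ezero : ∀ {n} {xs : Vec ℕ n} → Eval rzero xs 0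
  esucc : ∀ {x} → Eval rsucc (x ∷ []) (suc x)
  eproj : ∀ {n} {i : Fin n} {xs} → Eval (rproj i) xs (lookup xs i)
  ecomp : ∀ {m n} {f : Rec m} {hs : Fin m → Rec n} {xs} {ys : Vec ℕ m} {y} →
          (∀ i → Eval (hs i) xs (lookup ys i)) → Eval f ys y →
          Eval (rcomp f hs) xs y
  erec0 : ∀ {n} {f : Rec n} {h} {xs} {y} →
          Eval f xs y → Eval (rrec f h) (0 ∷ xs) y
  erecS : ∀ {n} {f : Rec n} {h} {k} {xs} {z} {y} →
          Eval (rrec f h) (k ∷ xs) z → Eval h (k ∷ z ∷ xs) y →
          Eval (rrec f h) (suc k ∷ xs) y
  emu   : ∀ {n} {f : Rec (suc n)} {xs} {y} →
          Eval f (y ∷ xs) 0 →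
          (∀ z → z < y → Σ ℕ λ k → Eval f (z ∷ xs) (suc k)) →
          Eval (rmu f) xs y

Computable : (ℕ → ℕ) → Set
Computable f = Σ (Rec 1) λ e → ∀ x → Eval e (x ∷ []) (f x)

-- Punctual partial orders / trees.  A structure in the language {≤}
-- with domain ω is given by the characteristic function of ≤.

Str : Set
Str = ℕ → ℕ → Bool

Punctual : Str → Set
Punctual = PrimRecRel

module _ (T : Str) where
  _≤T_ : ℕ → ℕ → Set
  x ≤T y = T x y ≡ true

  _<T_ : ℕ → ℕ → Set
  x <T y = x ≤T y × x ≢ y

  IsPartialOrder : Set
  IsPartialOrder = (∀ x → x ≤T x)
                 × (∀ x y → x ≤T y → y ≤T x → x ≡ y)
                 × (∀ x y z → x ≤T y → y ≤T z → x ≤T z)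

  PredFiniteLinear : ℕ → Set
  PredFiniteLinear x =
      (Σ (List ℕ) λ l → ∀ y → y <T x → y ∈ l)
    × (∀ y z → y <T x → z <T x → y ≤T z ⊎ z ≤T y)

  IsTree : Set
  IsTree = IsPartialOrder
         × (Σ ℕ λ r → ∀ x → r ≤T x)
         × (∀ x → PredFiniteLinear x)

  data Chain : List ℕ → Set where
    cnil  : Chain []
    cone  : ∀ x → Chain (x ∷ [])
    ccons : ∀ x y l → x <T y → Chain (y ∷ l) → Chain (x ∷ y ∷ l)

  FiniteHeight : Set
  FiniteHeight = Σ ℕ λ h → ∀ l → Chain l → length l ≤ h

  ImmSucc : ℕ → ℕ → Set
  ImmSucc a b = a <T b × ¬ (Σ ℕ λ c → a <T c × c <T b)

  InfManyImmSucc : ℕ → Set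
  InfManyImmSucc a = ∀ n → Σ ℕ λ b → n ≤ b × ImmSucc a b

  Condition1 : Set
  Condition1 = Σ ℕ λ a → Σ ℕ λ b → a ≢ b × InfManyImmSucc a × InfManyImmSucc b

  Condition2 : Set
  Condition2 = Σ ℕ λ a → InfManyImmSucc a
             × (∀ a' → InfManyImmSucc a' → a' ≡ a)
             × (∀ b → ImmSucc a b → Σ ℕ λ c → ImmSucc b c)

IsIso : Str → Str → (ℕ → ℕ) → (ℕ → ℕ) → Set
IsIso A B f finv = (∀ x → finv (f x) ≡ x) × (∀ y → f (finv y) ≡ y)
                 × (∀ x y → A x y ≡ B (f x) (f y))

Isomorphic : Str → Str → Set
Isomorphic A B = Σ (ℕ → ℕ) λ f → Σ (ℕ → ℕ) λ finv → IsIso A B f finv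

-- d ∈ PrCat(A), with the PR-degree represented by a member d
InPrCat : Str → (ℕ → ℕ) → Set
InPrCat A d = ∀ B → Punctual B → Isomorphic A B →
  Σ (ℕ → ℕ) λ f → Σ (ℕ → ℕ) λ finv → IsIso A B f finv × f ≤PR d × finv ≤PR d

InConeΔ01 : (ℕ → ℕ) → Set
InConeΔ01 d = ∀ f → Computable f → f ≤PR d

{-# OPTIONS --safe #-}
module Submission where

-- A node with infinitely many immediate successors lets a punctual copy of T grow by speculative
-- elements above it, to be matched later, first come first served, with elements that T is bound to
-- show. So a copy may add nothing but speculative elements of one kind while it waits for a given
-- computation to converge, whereas another copy adds elements of both kinds at a primitive recursive
-- rate. An isomorphism from the fast to the slow copy must send many elements of the other kind beyond
-- the waiting period, and so bounds the running time. With two infinitely branching nodes a and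
-- b, the kinds are lone elements above a and above b; with only one, a, they are the lower and the upper
-- elements of pairs above a. An isomorphism may move a and b, but by finite height no automorphism moves
-- a node strictly down, which always leaves a suitable choice of the kind to wait with. The choice is
-- made by finitely many comparisons in T, so no undecidable case distinction is needed.

-- The fast side cannot be T itself, since T may show nodes above the anchors arbitrarily slowly. So
-- categoricity is applied to both copies, and the isomorphism `h` between them is composed through
-- T. Nothing forces it to agree with the constructed maps `π` onto T; the deviation is an unknown
-- automorphism `σ` of T, which depends on the kind used for waiting. This is why the choice of that
-- kind needs an argument. The counting is as follows. Let no tick occur from stage s up to t. All
-- elements added meanwhile have the waiting kind, and one whose number is at least s is matched by
-- an event at s or later. So an element added before s lies below it only if it lies below the
-- anchor, and distinct elements of one kind are incomparable. Hence if u < w in the fast copy, u is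
-- not sent below the waiting anchor and both images come before t, then w is sent to one of s early
-- stages or to one of s small numbers. With 2 s + 1 such pairs some image reaches t or beyond,
-- which bounds the next tick. Iterating this bound, once per argument, yields enough fuel for the
-- computation.

open import Defs
open import Data.Bool using (Bool; true; false; if_then_else_; _∧_; _∨_; not)
open import Data.Bool.Properties using (∧-zeroʳ; ∨-zeroʳ)
open import Data.Empty using (⊥; ⊥-elim)
open import Data.Fin using (Fin; zero; suc; toℕ; fromℕ<; #_)
open import Data.Fin.Properties using (pigeonhole; toℕ-fromℕ<; toℕ<n)
open import Data.List using (List; []; _∷_; length)
open import Data.List.Membership.Propositional using (_∈_)
open import Data.List.Relation.Unary.Any using (here; there)
open import Data.Nat using (ℕ; zero; suc; pred; _+_; _*_; _∸_; _⊔_; _≤_; _<_; z≤n; s≤s; z<s; s<s; s≤s⁻¹; _<ᵇ_; _≡ᵇ_)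
open import Data.Nat.Properties
open import Data.Product using (Σ; _×_; _,_; proj₁; proj₂)
open import Data.Sum using (_⊎_; inj₁; inj₂)
open import Data.Vec using (Vec; []; _∷_; lookup; tabulate; head; tail)
open import Data.Vec.Properties using (tabulate-cong; tabulate∘lookup)
open import Function using (_∘_)
open import Relation.Binary.Definitions using (tri<; tri≈; tri>)
open import Relation.Binary.PropositionalEquality
open import Relation.Nullary using (¬_; Dec; yes; no; contradiction)

-- Booleans and bounded operators

true≢false : true ≢ false
true≢false ()

∧-true : ∀ {x y} → x ∧ y ≡ true → x ≡ true × y ≡ true
∧-true {true} {true} _ = refl , refl

∧-intro : ∀ {x y} → x ≡ true → y ≡ true → x ∧ y ≡ true
∧-intro refl refl = refl

∨-true : ∀ {x y} → x ∨ y ≡ true → x ≡ true ⊎ y ≡ true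
∨-true {true} _ = inj₁ refl
∨-true {false} q = inj₂ q

∨-introʳ : ∀ x {y} → y ≡ true → x ∨ y ≡ true
∨-introʳ x refl = ∨-zeroʳ x

∨-introˡ : ∀ {x} y → x ≡ true → x ∨ y ≡ true
∨-introˡ y refl = refl

not-true : ∀ {x} → not x ≡ true → x ≡ false
not-true {false} _ = refl

not-intro : ∀ {x} → ¬ (x ≡ true) → not x ≡ true
not-intro {true} q = ⊥-elim (q refl)
not-intro {false} _ = refl

not-elim : ∀ {x} → not x ≡ true → ¬ (x ≡ true)
not-elim {false} _ ()

¬true : ∀ {x} → ¬ (x ≡ true) → x ≡ false
¬true {true} q = ⊥-elim (q refl)
¬true {false} _ = refl

bool-ext : ∀ {x y} → (x ≡ true → y ≡ true) → (y ≡ true → x ≡ true) → x ≡ y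
bool-ext {true} p q = sym (p refl)
bool-ext {false} {true} p q = q refl
bool-ext {false} {false} p q = refl

decide : ∀ b → b ≡ true ⊎ b ≡ false
decide true = inj₁ refl
decide false = inj₂ refl

<ᵇ-true : ∀ m n → (m <ᵇ n) ≡ true → m < n
<ᵇ-true zero (suc n) _ = z<s
<ᵇ-true (suc m) (suc n) q = s<s (<ᵇ-true m n q)

<ᵇ-intro : ∀ {m n} → m < n → (m <ᵇ n) ≡ true
<ᵇ-intro {zero} {suc n} _ = refl
<ᵇ-intro {suc m} {suc n} (s≤s q) = <ᵇ-intro q

≥⇒<ᵇ-false : ∀ {m n} → n ≤ m → (m <ᵇ n) ≡ false
≥⇒<ᵇ-false q = ¬true λ r → <⇒≱ (<ᵇ-true _ _ r) q

≡ᵇ-true : ∀ m n → (m ≡ᵇ n) ≡ true → m ≡ n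
≡ᵇ-true zero zero _ = refl
≡ᵇ-true (suc m) (suc n) q = cong suc (≡ᵇ-true m n q)

≡ᵇ-refl : ∀ m → (m ≡ᵇ m) ≡ true
≡ᵇ-refl zero = refl
≡ᵇ-refl (suc m) = ≡ᵇ-refl m

≡ᵇ-intro : ∀ {m n} → m ≡ n → (m ≡ᵇ n) ≡ true
≡ᵇ-intro {m} refl = ≡ᵇ-refl m

≢⇒≡ᵇ-false : ∀ {m n} → m ≢ n → (m ≡ᵇ n) ≡ false
≢⇒≡ᵇ-false q = ¬true λ r → q (≡ᵇ-true _ _ r)

b2n : Bool → ℕ
b2n b = if b then 1 else 0

anyᵇ : ℕ → (ℕ → Bool) → Bool
anyᵇ zero P = false
anyᵇ (suc n) P = anyᵇ n P ∨ P n

allᵇ : ℕ → (ℕ → Bool) → Bool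
allᵇ zero P = true
allᵇ (suc n) P = allᵇ n P ∧ P n

count : ℕ → (ℕ → Bool) → ℕ
count zero P = 0
count (suc n) P = count n P + b2n (P n)

-- The least i < n with P i, and n if there is none.
least : ℕ → (ℕ → Bool) → ℕ
least zero P = 0
least (suc n) P = if anyᵇ n P then least n P else (if P n then n else suc n)

maxOver : ℕ → (ℕ → ℕ) → ℕ
maxOver zero f = 0
maxOver (suc n) f = maxOver n f ⊔ f n

anyᵇ-true : ∀ n P → anyᵇ n P ≡ true → Σ ℕ λ i → i < n × P i ≡ true
anyᵇ-true (suc n) P q with ∨-true {anyᵇ n P} q
... | inj₁ r = let i , i<n , Pi = anyᵇ-true n P r in i , m<n⇒m<1+n i<n , Pi
... | inj₂ r = n , n<1+n n , r

anyᵇ-intro : ∀ {n} P {i} → i < n → P i ≡ true → anyᵇ n P ≡ true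
anyᵇ-intro {suc n} P {i} i<n Pi with m≤n⇒m<n∨m≡n (s≤s⁻¹ i<n)
... | inj₁ r = ∨-introˡ (P n) (anyᵇ-intro P r Pi)
... | inj₂ refl = ∨-introʳ (anyᵇ n P) Pi

anyᵇ-false : ∀ {n} P {i} → anyᵇ n P ≡ false → i < n → P i ≡ false
anyᵇ-false P q i<n = ¬true λ r → true≢false (trans (sym (anyᵇ-intro P i<n r)) q)

allᵇ-true : ∀ {n} P {i} → allᵇ n P ≡ true → i < n → P i ≡ true
allᵇ-true {suc n} P {i} q i<n with m≤n⇒m<n∨m≡n (s≤s⁻¹ i<n)
... | inj₁ r = allᵇ-true P (proj₁ (∧-true q)) r
... | inj₂ refl = proj₂ (∧-true {allᵇ n P} q)

allᵇ-intro : ∀ n P → (∀ i → i < n → P i ≡ true) → allᵇ n P ≡ true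
allᵇ-intro zero P q = refl
allᵇ-intro (suc n) P q =
  ∧-intro (allᵇ-intro n P λ i r → q i (m<n⇒m<1+n r)) (q n (n<1+n n))

count-mono : ∀ {m n} P → m ≤ n → count m P ≤ count n P
count-mono {n = zero} P z≤n = z≤n
count-mono {m} {suc n} P q with m≤n⇒m<n∨m≡n q
... | inj₁ r = ≤-trans (count-mono P (s≤s⁻¹ r)) (m≤m+n _ _)
... | inj₂ refl = ≤-refl

count-step : ∀ {m n} P → m < n → P m ≡ true → count m P < count n P
count-step {m} P m<n Pm = ≤-trans (≤-reflexive eq) (count-mono P m<n)
  where
  eq : suc (count m P) ≡ count (suc m) P
  eq rewrite Pm = +-comm 1 (count m P)

count≤ : ∀ n P → count n P ≤ n
count≤ zero P = z≤n
count≤ (suc n) P with P n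
... | true = ≤-trans (≤-reflexive (+-comm _ 1)) (s≤s (count≤ n P))
... | false = ≤-trans (≤-reflexive (+-identityʳ _)) (m≤n⇒m≤1+n (count≤ n P))

count-injective : ∀ {m n} P → P m ≡ true → P n ≡ true → count m P ≡ count n P → m ≡ n
count-injective {m} {n} P Pm Pn q with <-cmp m n
... | tri< r _ _ = contradiction q (<⇒≢ (count-step P r Pm))
... | tri≈ _ r _ = r
... | tri> _ _ r = contradiction (sym q) (<⇒≢ (count-step P r Pn))

count-hit : ∀ n P k → k < count n P → Σ ℕ λ i → i < n × P i ≡ true × count i P ≡ k
count-hit (suc n) P k q with k <? count n P
... | yes r = let i , i<n , Pi , e = count-hit n P k r in i , m<n⇒m<1+n i<n , Pi , e
... | no r with P n in eq
...   | true = n , n<1+n n , eq ,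
               ≤-antisym (≮⇒≥ r) (s≤s⁻¹ (≤-trans q (≤-reflexive (+-comm _ 1))))
...   | false = ⊥-elim (r (≤-trans q (≤-reflexive (+-identityʳ _))))

count-unbounded : ∀ P → (∀ N → Σ ℕ λ n → N ≤ n × P n ≡ true) → ∀ k → Σ ℕ λ n → k < count n P
count-unbounded P inf zero =
  let n , _ , Pn = inf 0 in suc n , ≤-<-trans z≤n (count-step P (n<1+n n) Pn)
count-unbounded P inf (suc k) =
  let N , k<N = count-unbounded P inf k
      n , N≤n , Pn = inf N
  in suc n , ≤-<-trans (≤-trans k<N (count-mono P N≤n)) (count-step P (n<1+n n) Pn)

nth : ∀ P → (∀ N → Σ ℕ λ n → N ≤ n × P n ≡ true) →
      ∀ k → Σ ℕ λ n → P n ≡ true × count n P ≡ k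
nth P inf k = let N , k<N = count-unbounded P inf k
                  n , _ , Pn , eq = count-hit N P k k<N in n , Pn , eq

record IsLeast (n : ℕ) (P : ℕ → Bool) (i : ℕ) : Set where
  field
    bound : i < n
    holds : P i ≡ true
    below : ∀ {j} → j < i → P j ≡ false

least-spec : ∀ n P → anyᵇ n P ≡ true → IsLeast n P (least n P)
least-spec (suc n) P q with anyᵇ n P in eq
... | true = record { bound = m<n⇒m<1+n bound ; holds = holds ; below = below }
  where open IsLeast (least-spec n P eq)
... | false with P n in eq′
...   | true = record { bound = n<1+n n ; holds = eq′ ; below = anyᵇ-false P eq }

least-none : ∀ n P → anyᵇ n P ≡ false → least n P ≡ n
least-none zero P q = refl
least-none (suc n) P q with anyᵇ n P | P n
least-none (suc n) P () | true | _
least-none (suc n) P q | false | false = refl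

least-exists : ∀ P n → P n ≡ true → Σ ℕ λ i → i ≤ n × P i ≡ true × (∀ {j} → j < i → P j ≡ false)
least-exists P n Pn = least (suc n) P , s≤s⁻¹ bound , holds , below
  where open IsLeast (least-spec (suc n) P (anyᵇ-intro P (n<1+n n) Pn))

maxOver-upper : ∀ n f {i} → i < n → f i ≤ maxOver n f
maxOver-upper (suc n) f i<n with m≤n⇒m<n∨m≡n (s≤s⁻¹ i<n)
... | inj₁ r = ≤-trans (maxOver-upper n f r) (m≤m⊔n _ _)
... | inj₂ refl = m≤n⊔m (maxOver n f) _

-- Integer square roots and the sawtooth enumeration

isqrt : ℕ → ℕ
isqrt zero = 0
-- With m the root of n, the test says that n + 1 is still below (m + 1) squared.
isqrt (suc n) = if n <ᵇ isqrt n * isqrt n + 2 * isqrt n then isqrt n else suc (isqrt n)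

square-suc : ∀ m → suc m * suc m ≡ suc (m * m + 2 * m)
square-suc m rewrite *-suc m m | +-identityʳ m = cong suc
  (trans (sym (+-assoc m m (m * m))) (+-comm (m + m) (m * m)))

isqrt-stay : ∀ n {m} → isqrt n ≡ m → n < m * m + 2 * m → isqrt (suc n) ≡ m
isqrt-stay n refl q rewrite <ᵇ-intro q = refl

isqrt-up : ∀ n {m} → isqrt n ≡ m → m * m + 2 * m ≤ n → isqrt (suc n) ≡ suc m
isqrt-up n refl q rewrite ≥⇒<ᵇ-false q = refl

-- The block of numbers with root m is traversed one by one; its first element is entered from the
-- last one of the block before.
isqrt-spec : ∀ m z → z ≤ 2 * m → isqrt (m * m + z) ≡ m
isqrt-spec zero zero q = refl
isqrt-spec (suc m) zero q = trans
  (cong isqrt (trans (+-identityʳ (suc m * suc m)) (square-suc m)))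
  (isqrt-up (m * m + 2 * m) (isqrt-spec m (2 * m) ≤-refl) ≤-refl)
isqrt-spec m (suc z) q = trans (cong isqrt (+-suc (m * m) z))
  (isqrt-stay (m * m + z) (isqrt-spec m z (<⇒≤ q)) (+-monoʳ-< (m * m) q))

-- Enumerates every number infinitely often.
sawtooth : ℕ → ℕ
sawtooth t = t ∸ isqrt t * isqrt t

sawtooth-spec : ∀ m z → z ≤ 2 * m → sawtooth (m * m + z) ≡ z
sawtooth-spec m z q rewrite isqrt-spec m z q = m+n∸m≡n (m * m) z

n≤n*n : ∀ n → n ≤ n * n
n≤n*n zero = z≤n
n≤n*n (suc n) = m≤m*n (suc n) (suc n)

-- A term calculus for functions primitive recursive in g

module Definable (g : ℕ → ℕ) where

  -- A term travels with the function it computes, so the combinators below mirror the body of a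
  -- function and no term is ever inspected.
  record Def {n} (F : Vec ℕ n → ℕ) : Set where
    constructor def
    field
      term  : PR n
      sound : ∀ xs → ⟦ term ⟧ g xs ≡ F xs
  open Def public

  record Defᵇ {n} (P : Vec ℕ n → Bool) : Set where
    constructor defᵇ
    field numeric : Def (λ xs → b2n (P xs))
  open Defᵇ public

  ext : ∀ {n} {F G : Vec ℕ n → ℕ} → (∀ xs → F xs ≡ G xs) → Def F → Def G
  ext e (def t s) = def t λ xs → trans (s xs) (e xs)

  var : ∀ {n} (i : Fin n) → Def (λ xs → lookup xs i)
  var i = def (pproj i) λ _ → refl

  compose : ∀ {m n} {F : Vec ℕ m → ℕ} {G : Fin m → Vec ℕ n → ℕ} →
            Def F → (∀ i → Def (G i)) → Def (λ xs → F (tabulate (λ i → G i xs)))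
  compose {F = F} (def t s) ds = def (pcomp t (λ i → term (ds i)))
    λ xs → trans (s _) (cong F (tabulate-cong (λ i → sound (ds i) xs)))

  ⟨_⟩₁ : ∀ {n} {G : Vec ℕ n → ℕ} → Def G → (i : Fin 1) → Def (lookup (G ∷ []) i)
  ⟨ a ⟩₁ zero = a

  ⟨_,_⟩₂ : ∀ {n} {G H : Vec ℕ n → ℕ} → Def G → Def H → (i : Fin 2) → Def (lookup (G ∷ H ∷ []) i)
  ⟨ a , b ⟩₂ zero = a
  ⟨ a , b ⟩₂ (suc zero) = b

  ⟨_,_,_⟩₃ : ∀ {n} {G H K : Vec ℕ n → ℕ} → Def G → Def H → Def K →
             (i : Fin 3) → Def (lookup (G ∷ H ∷ K ∷ []) i)
  ⟨ a , b , c ⟩₃ zero = a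
  ⟨ a , b , c ⟩₃ (suc zero) = b
  ⟨ a , b , c ⟩₃ (suc (suc zero)) = c

  comp₁ : ∀ {n} {F : Vec ℕ 1 → ℕ} {G : Vec ℕ n → ℕ} → Def F → Def G → Def (λ xs → F (G xs ∷ []))
  comp₁ f a = compose f ⟨ a ⟩₁

  comp₂ : ∀ {n} {F : Vec ℕ 2 → ℕ} {G H : Vec ℕ n → ℕ} →
          Def F → Def G → Def H → Def (λ xs → F (G xs ∷ H xs ∷ []))
  comp₂ f a b = compose f ⟨ a , b ⟩₂

  comp₃ : ∀ {n} {F : Vec ℕ 3 → ℕ} {G H K : Vec ℕ n → ℕ} →
          Def F → Def G → Def H → Def K → Def (λ xs → F (G xs ∷ H xs ∷ K xs ∷ []))
  comp₃ f a b c = compose f ⟨ a , b , c ⟩₃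

  compᵇ₁ : ∀ {n} {P : Vec ℕ 1 → Bool} {G : Vec ℕ n → ℕ} → Defᵇ P → Def G → Defᵇ (λ xs → P (G xs ∷ []))
  compᵇ₁ (defᵇ f) a = defᵇ (comp₁ f a)

  compᵇ₂ : ∀ {n} {P : Vec ℕ 2 → Bool} {G H : Vec ℕ n → ℕ} →
           Defᵇ P → Def G → Def H → Defᵇ (λ xs → P (G xs ∷ H xs ∷ []))
  compᵇ₂ (defᵇ f) a b = defᵇ (comp₂ f a b)

  -- `G` may be any function that satisfies the recursion equations, so functions defined by
  -- structural recursion are covered as they stand.
  recursion : ∀ {n} (G : Vec ℕ (suc n) → ℕ) {F : Vec ℕ n → ℕ} {H : Vec ℕ (suc (suc n)) → ℕ} →
              Def F → Def H → (∀ xs → G (0 ∷ xs) ≡ F xs) →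
              (∀ k xs → G (suc k ∷ xs) ≡ H (k ∷ G (k ∷ xs) ∷ xs)) → Def G
  recursion G {F} {H} f h e₀ e₁ = def (prec (term f) (term h)) λ { (k ∷ xs) → go k xs }
    where
    go : ∀ k xs → evalRec (term f) (term h) g k xs ≡ G (k ∷ xs)
    go zero xs = trans (sound f xs) (sym (e₀ xs))
    go (suc k) xs = trans (sound h _)
      (trans (cong (λ r → H (k ∷ r ∷ xs)) (go k xs)) (sym (e₁ k xs)))

  constant : ∀ {n} k → Def {n} (λ _ → k)
  constant zero = def pzero λ _ → refl
  constant (suc k) = comp₁ (def {F = λ xs → suc (lookup xs (# 0))} psucc λ { (x ∷ []) → refl }) (constant k)

  infixl 6 _+ᴰ_ _∸ᴰ_
  infixl 7 _*ᴰ_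
  infix 4 _<ᴰ_ _≡ᴰ_
  infixr 2 _∨ᴰ_
  infixr 3 _∧ᴰ_

  sucᴰ : ∀ {n} {F : Vec ℕ n → ℕ} → Def F → Def (λ xs → suc (F xs))
  sucᴰ = comp₁ (def {F = λ xs → suc (lookup xs (# 0))} psucc λ { (x ∷ []) → refl })

  predᴰ : ∀ {n} {F : Vec ℕ n → ℕ} → Def F → Def (λ xs → pred (F xs))
  predᴰ = comp₁ (recursion (λ xs → pred (lookup xs (# 0))) (constant 0) (var (# 0))
    (λ _ → refl) (λ _ _ → refl))

  _+ᴰ_ : ∀ {n} {F G : Vec ℕ n → ℕ} → Def F → Def G → Def (λ xs → F xs + G xs)
  _+ᴰ_ = comp₂ (recursion (λ xs → lookup xs (# 0) + lookup xs (# 1)) (var (# 0)) (sucᴰ (var (# 1)))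
    (λ _ → refl) (λ _ _ → refl))

  _*ᴰ_ : ∀ {n} {F G : Vec ℕ n → ℕ} → Def F → Def G → Def (λ xs → F xs * G xs)
  _*ᴰ_ = comp₂ (recursion (λ xs → lookup xs (# 0) * lookup xs (# 1)) (constant 0)
    (var (# 2) +ᴰ var (# 1)) (λ _ → refl) (λ _ _ → refl))

  _∸ᴰ_ : ∀ {n} {F G : Vec ℕ n → ℕ} → Def F → Def G → Def (λ xs → F xs ∸ G xs)
  a ∸ᴰ b = comp₂ (recursion (λ xs → lookup xs (# 1) ∸ lookup xs (# 0)) (var (# 0)) (predᴰ (var (# 1)))
    (λ _ → refl) (λ k xs → sym (pred[m∸n]≡m∸[1+n] (lookup xs (# 0)) k))) b a

  _⊔ᴰ_ : ∀ {n} {F G : Vec ℕ n → ℕ} → Def F → Def G → Def (λ xs → F xs ⊔ G xs)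
  _⊔ᴰ_ {F = F} {G} a b = ext (λ xs → sym (m⊔n≡m+n∸m (F xs) (G xs))) (a +ᴰ (b ∸ᴰ a))
    where
    m⊔n≡m+n∸m : ∀ m n → m ⊔ n ≡ m + (n ∸ m)
    m⊔n≡m+n∸m zero n = refl
    m⊔n≡m+n∸m (suc m) zero = sym (+-identityʳ _)
    m⊔n≡m+n∸m (suc m) (suc n) = cong suc (m⊔n≡m+n∸m m n)

  ifᴰ_then_else_ : ∀ {n} {P : Vec ℕ n → Bool} {F G : Vec ℕ n → ℕ} →
                   Defᵇ P → Def F → Def G → Def (λ xs → if P xs then F xs else G xs)
  ifᴰ_then_else_ {P = P} (defᵇ p) a b =
    ext (λ xs → select-b2n (P xs)) (comp₃ selectᴰ p a b)
    where
    select : ℕ → ℕ → ℕ → ℕ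
    select zero x y = y
    select (suc _) x y = x
    select-b2n : ∀ t {x y} → select (b2n t) x y ≡ (if t then x else y)
    select-b2n true = refl
    select-b2n false = refl
    selectᴰ : Def {3} (λ xs → select (lookup xs (# 0)) (lookup xs (# 1)) (lookup xs (# 2)))
    selectᴰ = recursion _ (var (# 1)) (var (# 2)) (λ _ → refl) (λ _ _ → refl)

  _<ᴰ_ : ∀ {n} {F G : Vec ℕ n → ℕ} → Def F → Def G → Defᵇ (λ xs → F xs <ᵇ G xs)
  _<ᴰ_ {F = F} {G} a b = defᵇ (ext (λ xs → eq (F xs) (G xs)) (constant 1 ∸ᴰ (constant 1 ∸ᴰ (b ∸ᴰ a))))
    where
    eq : ∀ m n → 1 ∸ (1 ∸ (n ∸ m)) ≡ b2n (m <ᵇ n)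
    eq zero zero = refl
    eq zero (suc n) rewrite 0∸n≡0 n = refl
    eq (suc m) zero = refl
    eq (suc m) (suc n) = eq m n

  trueᴰ : ∀ {n} → Defᵇ {n} (λ _ → true)
  trueᴰ = defᵇ (constant 1)

  notᴰ : ∀ {n} {P : Vec ℕ n → Bool} → Defᵇ P → Defᵇ (λ xs → not (P xs))
  notᴰ {P = P} (defᵇ p) = defᵇ (ext (λ xs → eq (P xs)) (constant 1 ∸ᴰ p))
    where
    eq : ∀ b → 1 ∸ b2n b ≡ b2n (not b)
    eq true = refl
    eq false = refl

  _∧ᴰ_ : ∀ {n} {P Q : Vec ℕ n → Bool} → Defᵇ P → Defᵇ Q → Defᵇ (λ xs → P xs ∧ Q xs)
  _∧ᴰ_ {P = P} (defᵇ p) (defᵇ q) = defᵇ (ext (λ xs → eq (P xs)) (p *ᴰ q))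
    where
    eq : ∀ a {b} → b2n a * b2n b ≡ b2n (a ∧ b)
    eq true = +-identityʳ _
    eq false = refl

  _∨ᴰ_ : ∀ {n} {P Q : Vec ℕ n → Bool} → Defᵇ P → Defᵇ Q → Defᵇ (λ xs → P xs ∨ Q xs)
  _∨ᴰ_ {P = P} {Q} p q = defᵇ (ext (λ xs → eq (P xs) (Q xs)) (numeric (notᴰ (notᴰ p ∧ᴰ notᴰ q))))
    where
    eq : ∀ a b → b2n (not (not a ∧ not b)) ≡ b2n (a ∨ b)
    eq true b = refl
    eq false true = refl
    eq false false = refl

  _≡ᴰ_ : ∀ {n} {F G : Vec ℕ n → ℕ} → Def F → Def G → Defᵇ (λ xs → F xs ≡ᵇ G xs)
  _≡ᴰ_ {F = F} {G} a b = defᵇ (ext (λ xs → cong b2n (eq (F xs) (G xs)))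
      (numeric (notᴰ (a <ᴰ b) ∧ᴰ notᴰ (b <ᴰ a))))
    where
    eq : ∀ m n → not (m <ᵇ n) ∧ not (n <ᵇ m) ≡ (m ≡ᵇ n)
    eq zero zero = refl
    eq zero (suc n) = refl
    eq (suc m) zero = refl
    eq (suc m) (suc n) = eq m n

  ifᵇ_then_else_ : ∀ {n} {P Q R : Vec ℕ n → Bool} →
                   Defᵇ P → Defᵇ Q → Defᵇ R → Defᵇ (λ xs → if P xs then Q xs else R xs)
  ifᵇ_then_else_ {P = P} p (defᵇ q) (defᵇ r) = defᵇ (ext (λ xs → eq (P xs)) (ifᴰ p then q else r))
    where
    eq : ∀ t {x y} → (if t then b2n x else b2n y) ≡ b2n (if t then x else y)
    eq true = refl
    eq false = refl

  bounded : ∀ {n} {F : Vec ℕ n → ℕ} {G : Vec ℕ (suc n) → ℕ} →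
            Def G → Def F → Def (λ xs → G (F xs ∷ xs))
  bounded {n} {F} {G} d a =
    ext (λ xs → cong (λ ys → G (F xs ∷ ys)) (tabulate∘lookup xs)) (compose d args)
    where
    args : (i : Fin (suc n)) → Def (λ xs → lookup (F xs ∷ xs) i)
    args zero = a
    args (suc i) = var i

  -- For steps that depend on the counter and the parameters but not on the previous value, which
  -- sits in second place.
  dropAccumulator : ∀ {n} {G : Vec ℕ (suc n) → ℕ} → Def G →
                    Def {suc (suc n)} (λ { (k ∷ _ ∷ xs) → G (k ∷ xs) })
  dropAccumulator {n} {G} d =
    ext (λ { (k ∷ r ∷ xs) → cong (λ ys → G (k ∷ ys)) (tabulate∘lookup xs) }) (compose d args)
    where
    index : Fin (suc n) → Fin (suc (suc n))
    index zero = zero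
    index (suc i) = suc (suc i)
    args : (i : Fin (suc n)) → Def (λ xs → lookup xs (index i))
    args i = var (index i)

  dropAccumulatorᵇ : ∀ {n} {P : Vec ℕ (suc n) → Bool} → Defᵇ P →
                     Defᵇ {suc (suc n)} (λ { (k ∷ _ ∷ xs) → P (k ∷ xs) })
  dropAccumulatorᵇ (defᵇ p) = defᵇ (ext (λ { (k ∷ r ∷ xs) → refl }) (dropAccumulator p))

  countᴰ : ∀ {n} {F : Vec ℕ n → ℕ} {P : Vec ℕ (suc n) → Bool} →
           Def F → Defᵇ P → Def (λ xs → count (F xs) (λ i → P (i ∷ xs)))
  countᴰ {P = P} a p = bounded {G = λ { (k ∷ xs) → count k (λ i → P (i ∷ xs)) }}
    (recursion _ (constant 0) (var (# 1) +ᴰ numeric (dropAccumulatorᵇ p)) (λ _ → refl) (λ _ _ → refl)) a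

  maxOverᴰ : ∀ {n} {F : Vec ℕ n → ℕ} {G : Vec ℕ (suc n) → ℕ} →
             Def F → Def G → Def (λ xs → maxOver (F xs) (λ i → G (i ∷ xs)))
  maxOverᴰ {G = G} a d = bounded {G = λ { (k ∷ xs) → maxOver k (λ i → G (i ∷ xs)) }}
    (recursion _ (constant 0) (var (# 1) ⊔ᴰ dropAccumulator d) (λ _ → refl) (λ _ _ → refl)) a

  anyᴰ : ∀ {n} {F : Vec ℕ n → ℕ} {P : Vec ℕ (suc n) → Bool} →
         Def F → Defᵇ P → Defᵇ (λ xs → anyᵇ (F xs) (λ i → P (i ∷ xs)))
  anyᴰ {F = F} {P} a p = defᵇ (ext (λ xs → cong b2n (eq (F xs) _)) (numeric (constant 0 <ᴰ countᴰ a p)))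
    where
    eq : ∀ n Q → (0 <ᵇ count n Q) ≡ anyᵇ n Q
    eq n Q = bool-ext
      (λ r → let i , i<n , Qi , _ = count-hit n Q 0 (<ᵇ-true _ _ r) in anyᵇ-intro Q i<n Qi)
      (λ r → let i , i<n , Qi = anyᵇ-true n Q r in <ᵇ-intro (≤-<-trans z≤n (count-step Q i<n Qi)))

  allᴰ : ∀ {n} {F : Vec ℕ n → ℕ} {P : Vec ℕ (suc n) → Bool} →
         Def F → Defᵇ P → Defᵇ (λ xs → allᵇ (F xs) (λ i → P (i ∷ xs)))
  allᴰ {F = F} {P} a p = defᵇ (ext (λ xs → cong b2n (eq (F xs) _)) (numeric (notᴰ (anyᴰ a (notᴰ p)))))
    where
    eq : ∀ n Q → not (anyᵇ n (λ i → not (Q i))) ≡ allᵇ n Q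
    eq zero Q = refl
    eq (suc n) Q with anyᵇ n (λ i → not (Q i)) | Q n | eq n Q
    ... | true | _ | e rewrite sym e = refl
    ... | false | true | e rewrite sym e = refl
    ... | false | false | e rewrite sym e = refl

  leastᴰ : ∀ {n} {F : Vec ℕ n → ℕ} {P : Vec ℕ (suc n) → Bool} →
           Def F → Defᵇ P → Def (λ xs → least (F xs) (λ i → P (i ∷ xs)))
  leastᴰ {P = P} a p = bounded {G = λ { (k ∷ xs) → least k (λ i → P (i ∷ xs)) }}
    (recursion _ {H = λ { (k ∷ r ∷ xs) → if anyᵇ k (λ i → P (i ∷ xs)) then r else (if P (k ∷ xs) then k else suc k) }}
      (constant 0)
      (ext (λ { (k ∷ r ∷ xs) → refl })
        (ifᴰ dropAccumulatorᵇ (anyBelow p) then var (# 1)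
         else (ifᴰ dropAccumulatorᵇ p then var (# 0) else sucᴰ (var (# 0)))))
      (λ _ → refl) (λ _ _ → refl)) a
    where
    anyBelow : ∀ {n} {P : Vec ℕ (suc n) → Bool} → Defᵇ P →
               Defᵇ {suc n} (λ { (k ∷ xs) → anyᵇ k (λ i → P (i ∷ xs)) })
    anyBelow p = defᵇ (ext (λ { (k ∷ xs) → refl }) (numeric (anyᴰ (var (# 0)) (dropAccumulatorᵇ p))))

  isqrtᴰ : ∀ {n} {F : Vec ℕ n → ℕ} → Def F → Def (λ xs → isqrt (F xs))
  isqrtᴰ = comp₁ (recursion (λ xs → isqrt (lookup xs (# 0))) (constant 0)
    (ifᴰ var (# 0) <ᴰ var (# 1) *ᴰ var (# 1) +ᴰ constant 2 *ᴰ var (# 1)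
     then var (# 1) else sucᴰ (var (# 1)))
    (λ _ → refl) (λ _ _ → refl))

  sawtoothᴰ : ∀ {n} {F : Vec ℕ n → ℕ} → Def F → Def (λ xs → sawtooth (F xs))
  sawtoothᴰ a = a ∸ᴰ isqrtᴰ a *ᴰ isqrtᴰ a

  fromTerm : ∀ {f} → f ≤PR g → Def {1} (λ xs → f (lookup xs (# 0)))
  fromTerm (t , s) = def t λ { (x ∷ []) → s x }

  toTerm : ∀ {f} → Def {1} (λ xs → f (lookup xs (# 0))) → f ≤PR g
  toTerm (def t s) = t , λ x → s (x ∷ [])

-- Evaluation with fuel

allPositive : ∀ {m} → (Fin m → ℕ) → Bool
allPositive {zero} h = true
allPositive {suc m} h = (0 <ᵇ h zero) ∧ allPositive (λ i → h (suc i))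

-- fuel e s xs is suc y if e is seen to take the value y at xs within s steps, and 0 otherwise.
-- In fuelMu, 0 means that the search continues, 1 that it has met an undefined value,
-- and suc (suc y) that it has found y.
mutual
  fuel : ∀ {n} → Rec n → ℕ → Vec ℕ n → ℕ
  fuel rzero s xs = 1
  fuel rsucc s xs = suc (suc (head xs))
  fuel (rproj i) s xs = suc (lookup xs i)
  fuel (rcomp f hs) s xs =
    if allPositive (λ i → fuel (hs i) s xs) then fuel f s (tabulate (λ i → pred (fuel (hs i) s xs))) else 0
  fuel (rrec f h) s xs = fuelRec f h s (head xs) (tail xs)
  fuel (rmu f) s xs = pred (fuelMu f s s xs)

  fuelRec : ∀ {n} → Rec n → Rec (suc (suc n)) → ℕ → ℕ → Vec ℕ n → ℕ
  fuelRec f h s zero xs = fuel f s xs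
  fuelRec f h s (suc k) xs =
    if 0 <ᵇ fuelRec f h s k xs then fuel h s (k ∷ pred (fuelRec f h s k xs) ∷ xs) else 0

  fuelMu : ∀ {n} → Rec (suc n) → ℕ → ℕ → Vec ℕ n → ℕ
  fuelMu f s zero xs = 0
  fuelMu f s (suc k) xs = if 0 <ᵇ fuelMu f s k xs then fuelMu f s k xs
    else (if 0 <ᵇ fuel f s (k ∷ xs) then (if 1 <ᵇ fuel f s (k ∷ xs) then 0 else suc (suc k)) else 1)

allPositive-true : ∀ {m} (h : Fin m → ℕ) → allPositive h ≡ true → ∀ i → 0 < h i
allPositive-true h q zero = <ᵇ-true _ _ (proj₁ (∧-true q))
allPositive-true h q (suc i) = allPositive-true (λ i → h (suc i)) (proj₂ (∧-true {0 <ᵇ h zero} q)) i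

allPositive-intro : ∀ {m} (h : Fin m → ℕ) → (∀ i → 0 < h i) → allPositive h ≡ true
allPositive-intro {zero} h q = refl
allPositive-intro {suc m} h q = ∧-intro (<ᵇ-intro (q zero)) (allPositive-intro _ λ i → q (suc i))

allPositive-agree : ∀ {m} (h h′ : Fin m → ℕ) → (∀ i → h i ≡ 0 ⊎ h i ≡ h′ i) →
                    allPositive h ≡ true → ∀ i → h i ≡ h′ i
allPositive-agree h h′ q p i with q i
... | inj₁ r = ⊥-elim (<⇒≢ (allPositive-true h p i) (sym r))
... | inj₂ r = r

allPositive-cong : ∀ {m} {h h′ : Fin m → ℕ} → (∀ i → h i ≡ h′ i) → allPositive h ≡ allPositive h′
allPositive-cong {zero} q = refl
allPositive-cong {suc m} q = cong₂ _∧_ (cong (0 <ᵇ_) (q zero)) (allPositive-cong (λ i → q (suc i)))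

fuelMu-extend : ∀ {n} (f : Rec (suc n)) s xs {y} k k′ → k ≤ k′ →
                fuelMu f s k xs ≡ suc y → fuelMu f s k′ xs ≡ suc y
fuelMu-extend f s xs k zero z≤n q = q
fuelMu-extend f s xs k (suc k′) k≤k′ q with m≤n⇒m<n∨m≡n k≤k′
... | inj₂ refl = q
... | inj₁ r rewrite fuelMu-extend f s xs k k′ (s≤s⁻¹ r) q = refl

mutual
  -- Stated for the flat order with 0 as undefined, so that the induction passes through subterms
  -- whether or not they converge.
  fuel-mono : ∀ {n} (e : Rec n) {s s′} → s ≤ s′ → ∀ xs → fuel e s xs ≡ 0 ⊎ fuel e s xs ≡ fuel e s′ xs
  fuel-mono rzero le xs = inj₂ refl
  fuel-mono rsucc le xs = inj₂ refl
  fuel-mono (rproj i) le xs = inj₂ refl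
  fuel-mono (rcomp f hs) {s} {s′} le xs with allPositive (λ i → fuel (hs i) s xs) in eq
  ... | false = inj₁ refl
  ... | true with same ← allPositive-agree _ _ (λ i → fuel-mono (hs i) le xs) eq
    rewrite trans (sym (allPositive-cong same)) eq | tabulate-cong (λ i → cong pred (same i))
    = fuel-mono f le _
  fuel-mono (rrec f h) le xs = fuelRec-mono f h le (head xs) (tail xs)
  fuel-mono (rmu f) {s} {s′} le xs with fuelMu-mono f le s xs
  ... | inj₁ q rewrite q = inj₁ refl
  ... | inj₂ q with fuelMu f s s xs in eq
  ...   | zero = inj₁ refl
  -- More fuel also lengthens the search, which keeps a result once reached.
  ...   | suc y rewrite fuelMu-extend f s′ xs s s′ le (sym q) = inj₂ refl

  fuelRec-mono : ∀ {n} (f : Rec n) h {s s′} → s ≤ s′ → ∀ k xs →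
                 fuelRec f h s k xs ≡ 0 ⊎ fuelRec f h s k xs ≡ fuelRec f h s′ k xs
  fuelRec-mono f h le zero xs = fuel-mono f le xs
  fuelRec-mono f h {s} {s′} le (suc k) xs with fuelRec-mono f h le k xs
  ... | inj₁ q rewrite q = inj₁ refl
  ... | inj₂ q rewrite q with fuelRec f h s′ k xs
  ...   | zero = inj₁ refl
  ...   | suc r = fuel-mono h le _

  -- The undefined value is 1 here: 0 records that all earlier arguments gave positive values, and
  -- more fuel cannot change that.
  fuelMu-mono : ∀ {n} (f : Rec (suc n)) {s s′} → s ≤ s′ → ∀ k xs →
                fuelMu f s k xs ≡ 1 ⊎ fuelMu f s k xs ≡ fuelMu f s′ k xs
  fuelMu-mono f le zero xs = inj₂ refl
  fuelMu-mono f {s} {s′} le (suc k) xs with fuelMu-mono f le k xs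
  ... | inj₁ q rewrite q = inj₁ refl
  ... | inj₂ q rewrite q with fuelMu f s′ k xs
  ...   | suc r = inj₂ refl
  ...   | zero with fuel-mono f le (k ∷ xs)
  ...     | inj₁ q rewrite q = inj₁ refl
  ...     | inj₂ q rewrite q = inj₂ refl

fuel-mono-suc : ∀ {n} (e : Rec n) {s s′ xs y} → s ≤ s′ → fuel e s xs ≡ suc y → fuel e s′ xs ≡ suc y
fuel-mono-suc e {xs = xs} le q with fuel-mono e le xs
... | inj₁ r = ⊥-elim (0≢1+n (trans (sym r) q))
... | inj₂ r = trans (sym r) q

uniformBound : ∀ {m} (P : Fin m → ℕ → Set) → (∀ i {s s′} → s ≤ s′ → P i s → P i s′) →
               (∀ i → Σ ℕ (P i)) → Σ ℕ λ s → ∀ i → P i s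
uniformBound {zero} P mono ps = 0 , λ ()
uniformBound {suc m} P mono ps =
  let s , p = ps zero
      s′ , p′ = uniformBound (λ i → P (suc i)) (λ i → mono (suc i)) (λ i → ps (suc i))
  in s ⊔ s′ , λ { zero → mono zero (m≤m⊔n s s′) p ; (suc i) → mono (suc i) (m≤n⊔m s s′) (p′ i) }

fuelMu-searching : ∀ {n} (f : Rec (suc n)) s xs k →
                   (∀ z → z < k → Σ ℕ λ v → fuel f s (z ∷ xs) ≡ suc (suc v)) → fuelMu f s k xs ≡ 0
fuelMu-searching f s xs zero q = refl
fuelMu-searching f s xs (suc k) q
  rewrite fuelMu-searching f s xs k (λ z lt → q z (m<n⇒m<1+n lt)) | proj₂ (q k (n<1+n k)) = refl

fuelMu-found : ∀ {n} (f : Rec (suc n)) s xs y → fuelMu f s y xs ≡ 0 → fuel f s (y ∷ xs) ≡ 1 →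
               fuelMu f s (suc y) xs ≡ suc (suc y)
fuelMu-found f s xs y p q rewrite p | q = refl

fuel-complete : ∀ {n} {e : Rec n} {xs y} → Eval e xs y → Σ ℕ λ s → fuel e s xs ≡ suc y
fuel-complete ezero = 0 , refl
fuel-complete (esucc {x}) = 0 , refl
fuel-complete eproj = 0 , refl
fuel-complete (ecomp {f = f} {hs} {xs} {ys} {y} evs ev) =
  let s , p = uniformBound (λ i s → fuel (hs i) s xs ≡ suc (lookup ys i))
                (λ i → fuel-mono-suc (hs i)) (λ i → fuel-complete (evs i))
      s′ , q = fuel-complete ev
  in s ⊔ s′ , eq (λ i → fuel-mono-suc (hs i) (m≤m⊔n s s′) (p i)) (fuel-mono-suc f (m≤n⊔m s s′) q)
  where
  eq : ∀ {s} → (∀ i → fuel (hs i) s xs ≡ suc (lookup ys i)) → fuel f s ys ≡ suc y →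
       fuel (rcomp f hs) s xs ≡ suc y
  eq {s} p q
    rewrite allPositive-intro (λ i → fuel (hs i) s xs) (λ i → subst (0 <_) (sym (p i)) z<s)
          | tabulate-cong (λ i → cong pred (p i)) | tabulate∘lookup ys = q
fuel-complete (erec0 ev) = fuel-complete ev
fuel-complete (erecS {f = f} {h} {k} {xs} {z} ev ev′) =
  let s , p = fuel-complete ev
      s′ , q = fuel-complete ev′
  in s ⊔ s′ , eq (fuel-mono-suc (rrec f h) {xs = k ∷ xs} (m≤m⊔n s s′) p) (fuel-mono-suc h (m≤n⊔m s s′) q)
  where
  eq : ∀ {s y} → fuelRec f h s k xs ≡ suc z → fuel h s (k ∷ z ∷ xs) ≡ suc y →
       fuelRec f h s (suc k) xs ≡ suc y
  eq p q rewrite p = q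
fuel-complete (emu {f = f} {xs} {y} ev evs) =
  let s , p = fuel-complete ev
      s′ , q = below y ≤-refl
      -- `suc y` lets the search reach y; `s` and `s′` are fuel for the value 0 at y and for the
      -- positive values below y.
      S = suc y ⊔ (s ⊔ s′)
      le = ≤-trans (m≤m⊔n s s′) (m≤n⊔m (suc y) _)
      le′ = ≤-trans (m≤n⊔m s s′) (m≤n⊔m (suc y) _)
      searching = fuelMu-searching f S xs y (λ z lt → let v , r = q z lt in v , fuel-mono-suc f le′ r)
      found = fuelMu-found f S xs y searching (fuel-mono-suc f le p)
  in S , cong pred (fuelMu-extend f S xs (suc y) S (m≤m⊔n (suc y) (s ⊔ s′)) found)
  where
  positive : ∀ z → z < y → Σ ℕ λ s → Σ ℕ λ v → fuel f s (z ∷ xs) ≡ suc (suc v)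
  positive z lt with evs z lt
  ... | v , ev′ = let s , p = fuel-complete ev′ in s , v , p
  below : ∀ k → k ≤ y → Σ ℕ λ s → ∀ z → z < k → Σ ℕ λ v → fuel f s (z ∷ xs) ≡ suc (suc v)
  below zero le = 0 , λ z ()
  below (suc k) le =
    let s , p = below k (<⇒≤ le)
        s′ , v , q = positive k le
    in s ⊔ s′ , λ z lt → case z lt s s′ v p q (m≤n⇒m<n∨m≡n (s≤s⁻¹ lt))
    where
    case : ∀ z → z < suc k → ∀ s s′ v → (∀ z → z < k → Σ ℕ λ v → fuel f s (z ∷ xs) ≡ suc (suc v)) →
           fuel f s′ (k ∷ xs) ≡ suc (suc v) → z < k ⊎ z ≡ k → Σ ℕ λ v → fuel f (s ⊔ s′) (z ∷ xs) ≡ suc (suc v)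
    case z _ s s′ v p q (inj₁ lt) = let w , r = p z lt in w , fuel-mono-suc f (m≤m⊔n s s′) r
    case z _ s s′ v p q (inj₂ refl) = v , fuel-mono-suc f (m≤n⊔m s s′) q

-- Evaluation with fuel is primitive recursive

module FuelDefinable (g : ℕ → ℕ) where
  open Definable g

  rename : ∀ {m n} {F : Vec ℕ m → ℕ} → Def F → (ρ : Fin m → Fin n) →
           Def (λ xs → F (tabulate (λ i → lookup xs (ρ i))))
  rename d ρ = compose d λ i → var (ρ i)

  allPositiveᴰ : ∀ {m n} {G : Fin m → Vec ℕ n → ℕ} → (∀ i → Def (G i)) →
                 Defᵇ (λ xs → allPositive (λ i → G i xs))
  allPositiveᴰ {zero} ds = trueᴰ
  allPositiveᴰ {suc m} ds = constant 0 <ᴰ ds zero ∧ᴰ allPositiveᴰ (λ i → ds (suc i))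

  swap : ∀ {n} → Fin (suc (suc n)) → Fin (suc (suc n))
  swap zero = suc zero
  swap (suc zero) = zero
  swap (suc (suc i)) = suc (suc i)

  fuelᴰ : ∀ {n} (e : Rec n) → Def {suc n} (λ xs → fuel e (head xs) (tail xs))
  fuelᴰ rzero = constant 1
  fuelᴰ rsucc = ext (λ { (s ∷ x ∷ []) → refl }) (sucᴰ (sucᴰ (var (# 1))))
  fuelᴰ (rproj i) = ext (λ { (s ∷ xs) → refl }) (sucᴰ (var (suc i)))
  fuelᴰ (rcomp {m} {n} f hs) = ext (λ { (s ∷ xs) → refl })
    (ifᴰ allPositiveᴰ (λ i → fuelᴰ (hs i)) then compose (fuelᴰ f) args else constant 0)
    where
    values : Fin (suc m) → Vec ℕ (suc n) → ℕ
    values zero xs = lookup xs zero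
    values (suc i) xs = pred (fuel (hs i) (head xs) (tail xs))
    args : ∀ i → Def (values i)
    args zero = var zero
    args (suc i) = predᴰ (fuelᴰ (hs i))
  -- `recursion` runs on the first argument, which is the fuel here; `swap` brings the counter to
  -- the front.
  fuelᴰ (rrec {n} f h) =
    ext (λ { (s ∷ k ∷ xs) → cong (fuelRec f h s k) (tabulate∘lookup xs) })
      (rename (recursion (λ ys → fuelRec f h (head (tail ys)) (head ys) (tail (tail ys)))
        (fuelᴰ f) step (λ { (s ∷ xs) → refl })
        (λ { k (s ∷ xs) → cong (λ ys → if 0 <ᵇ fuelRec f h s k xs
               then fuel h s (k ∷ pred (fuelRec f h s k xs) ∷ ys) else 0) (sym (tabulate∘lookup xs)) })) swap)
    where
    values : Fin (suc (suc (suc n))) → Vec ℕ (suc (suc (suc n))) → ℕ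
    values zero xs = lookup xs (# 2)
    values (suc zero) xs = lookup xs (# 0)
    values (suc (suc zero)) xs = pred (lookup xs (# 1))
    values (suc (suc (suc i))) xs = lookup xs (suc (suc (suc i)))
    args : ∀ i → Def (values i)
    args zero = var (# 2)
    args (suc zero) = var (# 0)
    args (suc (suc zero)) = predᴰ (var (# 1))
    args (suc (suc (suc i))) = var (suc (suc (suc i)))
    step = ifᴰ constant 0 <ᴰ var (# 1) then compose (fuelᴰ h) args else constant 0
  -- The fuel serves both as the length of the search and as the fuel of each test, hence `double`.
  fuelᴰ (rmu {n} f) =
    ext (λ { (s ∷ xs) → cong (λ ys → pred (fuelMu f s s ys)) (tabulate∘lookup xs) })
      (predᴰ (rename (recursion (λ ys → fuelMu f (head (tail ys)) (head ys) (tail (tail ys)))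
        (constant 0) step (λ { (s ∷ xs) → refl })
        (λ { k (s ∷ xs) → cong (λ ys → if 0 <ᵇ fuelMu f s k xs then fuelMu f s k xs
               else (if 0 <ᵇ fuel f s (k ∷ ys) then (if 1 <ᵇ fuel f s (k ∷ ys) then 0 else suc (suc k)) else 1))
               (sym (tabulate∘lookup xs)) })) double))
    where
    double : Fin (suc (suc n)) → Fin (suc n)
    double zero = zero
    double (suc i) = i
    index : Fin (suc (suc n)) → Fin (suc (suc (suc n)))
    index zero = # 2
    index (suc zero) = # 0
    index (suc (suc i)) = suc (suc (suc i))
    value = rename (fuelᴰ f) index
    step = ifᴰ constant 0 <ᴰ var (# 1) then var (# 1)
           else (ifᴰ constant 0 <ᴰ value then (ifᴰ constant 1 <ᴰ value then constant 0 else sucᴰ (sucᴰ (var (# 0))))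
                 else constant 1)

noOracle : ℕ → ℕ
noOracle _ = 0

module _ where
  open Definable noOracle

  toPrimRec : ∀ {R} → Defᵇ {2} (λ v → R (lookup v (# 0)) (lookup v (# 1))) → PrimRecRel R
  toPrimRec (defᵇ (def t s)) = t , λ x y → s (x ∷ y ∷ [])

  fromPrimRec : ∀ {R} → PrimRecRel R → Defᵇ {2} (λ v → R (lookup v (# 0)) (lookup v (# 1)))
  fromPrimRec (t , s) = defᵇ (def t λ { (x ∷ y ∷ []) → s x y })

-- Speculative copies

least-unique : ∀ t P Y → P Y ≡ true → (∀ i → P i ≡ true → i ≡ Y) →
               (Y < t → least t P ≡ Y) × (t ≤ Y → least t P ≡ t)
least-unique t P Y PY unique with anyᵇ t P in eq
... | true = (λ _ → unique _ holds) , λ t≤Y → ⊥-elim (<⇒≱ (subst (_< t) (unique _ holds) bound) t≤Y)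
  where open IsLeast (least-spec t P eq)
... | false = (λ Y<t → ⊥-elim (true≢false (trans (sym (anyᵇ-intro P Y<t PY)) eq))) ,
              λ _ → least-none t P eq

-- A copy of T may contain elements of two kinds c < 2 whose counterparts in T are still unknown: they
-- are declared to lie above anchor c and to be incomparable to all else, except that a k-th element of
-- kind 0 lies below the k-th element of kind 1 if nested. The k-th y with event c y supplies the
-- counterpart member c y of the k-th element of kind c. A node z is copied only at a time t with
-- ready t z: the counterparts supplied from then on are related to z as declared.
record System (T : Str) : Set where
  open Definable noOracle
  field
    nested : Bool
    anchor : ℕ → ℕ
    event  : ℕ → ℕ → Bool
    member : ℕ → ℕ → ℕ
    ready  : ℕ → ℕ → Bool
    anchorᴰ : Def {1} (λ v → anchor (lookup v (# 0)))
    eventᴰ  : Defᵇ {2} (λ v → event (lookup v (# 0)) (lookup v (# 1)))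
    memberᴰ : Def {2} (λ v → member (lookup v (# 0)) (lookup v (# 1)))
    readyᴰ  : Defᵇ {2} (λ v → ready (lookup v (# 0)) (lookup v (# 1)))

  compatible : ℕ → ℕ → Bool
  compatible c c′ = (c ≡ᵇ c′) ∨ (nested ∧ (c <ᵇ c′))

  eventNumber : ℕ → ℕ → ℕ
  eventNumber c y = count y (event c)

  field
    event-infinite : ∀ c N → Σ ℕ λ y → N ≤ y × event c y ≡ true
    ready-eventually : ∀ z → Σ ℕ λ t → ∀ {t′} → t ≤ t′ → ready t′ z ≡ true
    late-above : ∀ {t z c y} → ready t z ≡ true → event c y ≡ true → t ≤ y → T (member c y) z ≡ false
    late-below : ∀ {t z c y} → ready t z ≡ true → event c y ≡ true → t ≤ y →
                 T z (member c y) ≡ T z (anchor c)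
    anchor-below : ∀ {c y} → event c y ≡ true → T (anchor c) (member c y) ≡ true
    anchor-strict : ∀ {c y} → event c y ≡ true → T (member c y) (anchor c) ≡ false
    members : ∀ {c c′ y y′} → c < 2 → c′ < 2 → event c y ≡ true → event c′ y′ ≡ true →
              T (member c y) (member c′ y′) ≡ (eventNumber c y ≡ᵇ eventNumber c′ y′) ∧ compatible c c′

-- Collects all that the comparison uses, for the fast and the slow copy alike; how the relation is
-- computed stays hidden.
record SpeculativeCopy (T : Str) (S : System T) (waiting : ℕ) (tick : ℕ → Bool) : Set where
  open System S
  field
    copy : Str
    copy-punctual : Punctual copy
    π : ℕ → ℕ
    ι : ℕ → ℕ
    π-ι : ∀ x → π (ι x) ≡ x
    π-injective : ∀ {n n′} → π n ≡ π n′ → n ≡ n′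
    copy≡T : ∀ n n′ → copy n n′ ≡ T (π n) (π n′)
    -- code n < 2 means that n is a speculative element of that kind, and code n = 2 + z that n copies z.
    code : ℕ → ℕ
    code-idle : ∀ {n} → tick n ≡ false → code n ≡ waiting
    code-tick : ∀ {n} → tick n ≡ true → sawtooth (count n tick) < 2 → code n ≡ sawtooth (count n tick)

  number : ℕ → ℕ
  number n = count n (λ i → code i ≡ᵇ code n)

  field
    target : ℕ → ℕ
    target-event : ∀ n → event (code n) (target n) ≡ true
    π-speculative : ∀ {n} → code n < 2 → π n ≡ member (code n) (target n)
    T-speculative : ∀ {n n′} → code n < 2 → code n′ < 2 →
      T (π n) (π n′) ≡ (number n ≡ᵇ number n′) ∧ compatible (code n) (code n′)
    -- A speculative element whose number exceeds n′ is matched only after everything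
    -- that has been copied before n′.
    lonely : ∀ {n n′} → code n < 2 → n′ < number n →
      T (π n′) (π n) ≡ true → T (π n′) (anchor (code n)) ≡ true

  isomorphic : Isomorphic T copy
  isomorphic = ι , π , π-ι , (λ n → π-injective (π-ι (π n))) ,
    λ x y → trans (sym (cong₂ T (π-ι x) (π-ι y))) (sym (copy≡T (ι x) (ι y)))

  number-injective : ∀ {n n′} → code n ≡ code n′ → number n ≡ number n′ → n ≡ n′
  number-injective {n} {n′} q r = count-injective (λ i → code i ≡ᵇ code n)
    (≡ᵇ-refl (code n)) (≡ᵇ-intro (sym q))
    (trans r (cong (λ c → count n′ (λ i → code i ≡ᵇ c)) (sym q)))

module Copy (T : Str) (T-refl : ∀ x → T x x ≡ true)
            (Tᴰ : Definable.Defᵇ noOracle {2} (λ v → T (lookup v (# 0)) (lookup v (# 1))))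
            (S : System T) (waiting : ℕ) (waiting<2 : waiting < 2)
            (tick : ℕ → Bool) (tickᴰ : Definable.Defᵇ noOracle {1} (λ v → tick (lookup v (# 0))))
            (tick-infinite : ∀ N → Σ ℕ λ n → N ≤ n × tick n ≡ true) where
  open System S
  open Definable noOracle

  -- Stages between ticks do not advance it, so the copy learns nothing more about T while it waits.
  time : ℕ → ℕ
  time n = count n tick

  isMember : ℕ → ℕ → Bool
  isMember t z = anyᵇ t λ y → (event 0 y ∧ (member 0 y ≡ᵇ z)) ∨ (event 1 y ∧ (member 1 y ≡ᵇ z))

  offered : ℕ → ℕ → Bool
  offered r t = (sawtooth t ≡ᵇ r) ∧ ready t (r ∸ 2)

  -- The first offer either copies the node or finds it to be a member. Later offers can therefore
  -- be refused without consulting what the copy did, and `code` needs no course-of-values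
  -- recursion.
  fresh : ℕ → ℕ → Bool
  fresh r t = ready t (r ∸ 2) ∧ not (isMember t (r ∸ 2)) ∧ not (anyᵇ t (offered r))

  accepted : ℕ → Bool
  accepted t = (sawtooth t <ᵇ 2) ∨ fresh (sawtooth t) t

  -- The domain is all of ω, so a stage that is idle or refuses an offer must still add something: a
  -- waiting element.
  code : ℕ → ℕ
  code n = if tick n ∧ accepted (time n) then sawtooth (time n) else waiting

  number : ℕ → ℕ
  number n = count n (λ i → code i ≡ᵇ code n)

  isEvent : ℕ → ℕ → Bool
  isEvent n y = event (code n) y ∧ (eventNumber (code n) y ≡ᵇ number n)

  -- Only bounded search is available here; the value t signals that the counterpart of n has not
  -- been supplied before t.
  eventBefore : ℕ → ℕ → ℕ
  eventBefore n t = least t (isEvent n)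

  -- The time of the copied node n′ decides, whichever of the two elements is added later: for
  -- counterparts not supplied by then, readiness of the node guarantees the declared relation. The
  -- same holds for `copiedBelow`.
  speculativeBelow : ℕ → ℕ → Bool
  speculativeBelow n n′ = (eventBefore n (time n′) <ᵇ time n′) ∧
    T (member (code n) (eventBefore n (time n′))) (code n′ ∸ 2)

  copiedBelow : ℕ → ℕ → Bool
  copiedBelow n n′ = T (code n ∸ 2) (if eventBefore n′ (time n) <ᵇ time n
    then member (code n′) (eventBefore n′ (time n)) else anchor (code n′))

  sameNumber : ℕ → ℕ → Bool
  sameNumber n n′ = (number n ≡ᵇ number n′) ∧ compatible (code n) (code n′)

  copy : Str
  copy n n′ =
    if code n <ᵇ 2
    then (if code n′ <ᵇ 2 then sameNumber n n′ else speculativeBelow n n′)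
    else (if code n′ <ᵇ 2 then copiedBelow n n′ else T (code n ∸ 2) (code n′ ∸ 2))

  timeᴰ : ∀ {n} {F : Vec ℕ n → ℕ} → Def F → Def (λ xs → time (F xs))
  timeᴰ a = countᴰ a (compᵇ₁ tickᴰ (var (# 0)))

  isMemberᴰ : Defᵇ {2} (λ v → isMember (lookup v (# 0)) (lookup v (# 1)))
  isMemberᴰ = anyᴰ (var (# 0))
    ((compᵇ₂ eventᴰ (constant 0) (var (# 0)) ∧ᴰ comp₂ memberᴰ (constant 0) (var (# 0)) ≡ᴰ var (# 2))
     ∨ᴰ (compᵇ₂ eventᴰ (constant 1) (var (# 0)) ∧ᴰ comp₂ memberᴰ (constant 1) (var (# 0)) ≡ᴰ var (# 2)))

  freshᴰ : Defᵇ {2} (λ v → fresh (lookup v (# 0)) (lookup v (# 1)))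
  freshᴰ = compᵇ₂ readyᴰ (var (# 1)) (var (# 0) ∸ᴰ constant 2)
    ∧ᴰ notᴰ (compᵇ₂ isMemberᴰ (var (# 1)) (var (# 0) ∸ᴰ constant 2))
    ∧ᴰ notᴰ (anyᴰ (var (# 1)) (sawtoothᴰ (var (# 0)) ≡ᴰ var (# 1)
                               ∧ᴰ compᵇ₂ readyᴰ (var (# 0)) (var (# 1) ∸ᴰ constant 2)))

  acceptedᴰ : Defᵇ {1} (λ v → accepted (lookup v (# 0)))
  acceptedᴰ = sawtoothᴰ (var (# 0)) <ᴰ constant 2 ∨ᴰ compᵇ₂ freshᴰ (sawtoothᴰ (var (# 0))) (var (# 0))

  codeᴰ : ∀ {n} {F : Vec ℕ n → ℕ} → Def F → Def (λ xs → code (F xs))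
  codeᴰ = comp₁ (ifᴰ compᵇ₁ tickᴰ (var (# 0)) ∧ᴰ compᵇ₁ acceptedᴰ (timeᴰ (var (# 0)))
                 then sawtoothᴰ (timeᴰ (var (# 0))) else constant waiting)

  numberᴰ : ∀ {n} {F : Vec ℕ n → ℕ} → Def F → Def (λ xs → number (F xs))
  numberᴰ = comp₁ (countᴰ (var (# 0)) (codeᴰ (var (# 0)) ≡ᴰ codeᴰ (var (# 1))))

  isEventᴰ : Defᵇ {2} (λ v → isEvent (lookup v (# 0)) (lookup v (# 1)))
  isEventᴰ = compᵇ₂ eventᴰ (codeᴰ (var (# 0))) (var (# 1))
    ∧ᴰ countᴰ (var (# 1)) (compᵇ₂ eventᴰ (codeᴰ (var (# 1))) (var (# 0))) ≡ᴰ numberᴰ (var (# 0))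

  eventBeforeᴰ : ∀ {n} {F G : Vec ℕ n → ℕ} → Def F → Def G → Def (λ xs → eventBefore (F xs) (G xs))
  eventBeforeᴰ = comp₂ (leastᴰ (var (# 1)) (compᵇ₂ isEventᴰ (var (# 1)) (var (# 0))))

  compatibleᴰ : ∀ {n} {F G : Vec ℕ n → ℕ} → Def F → Def G → Defᵇ (λ xs → compatible (F xs) (G xs))
  compatibleᴰ a b = a ≡ᴰ b ∨ᴰ (defᵇ (constant (b2n nested)) ∧ᴰ a <ᴰ b)

  speculativeBelowᴰ : Defᵇ {2} (λ v → speculativeBelow (lookup v (# 0)) (lookup v (# 1)))
  speculativeBelowᴰ = eventBeforeᴰ (var (# 0)) (timeᴰ (var (# 1))) <ᴰ timeᴰ (var (# 1))
    ∧ᴰ compᵇ₂ Tᴰ (comp₂ memberᴰ (codeᴰ (var (# 0))) (eventBeforeᴰ (var (# 0)) (timeᴰ (var (# 1)))))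
                 (codeᴰ (var (# 1)) ∸ᴰ constant 2)

  copiedBelowᴰ : Defᵇ {2} (λ v → copiedBelow (lookup v (# 0)) (lookup v (# 1)))
  copiedBelowᴰ = compᵇ₂ Tᴰ (codeᴰ (var (# 0)) ∸ᴰ constant 2)
    (ifᴰ eventBeforeᴰ (var (# 1)) (timeᴰ (var (# 0))) <ᴰ timeᴰ (var (# 0))
     then comp₂ memberᴰ (codeᴰ (var (# 1))) (eventBeforeᴰ (var (# 1)) (timeᴰ (var (# 0))))
     else comp₁ anchorᴰ (codeᴰ (var (# 1))))

  sameNumberᴰ : Defᵇ {2} (λ v → sameNumber (lookup v (# 0)) (lookup v (# 1)))
  sameNumberᴰ = numberᴰ (var (# 0)) ≡ᴰ numberᴰ (var (# 1))
    ∧ᴰ compatibleᴰ (codeᴰ (var (# 0))) (codeᴰ (var (# 1)))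

  speculativeᴰ : ∀ {n} (i : Fin n) → Defᵇ (λ v → code (lookup v i) <ᵇ 2)
  speculativeᴰ i = codeᴰ (var i) <ᴰ constant 2

  copyᴰ : Defᵇ {2} (λ v → copy (lookup v (# 0)) (lookup v (# 1)))
  copyᴰ =
    ifᵇ speculativeᴰ (# 0)
    then (ifᵇ speculativeᴰ (# 1) then sameNumberᴰ else speculativeBelowᴰ)
    else (ifᵇ speculativeᴰ (# 1) then copiedBelowᴰ
          else compᵇ₂ Tᴰ (codeᴰ (var (# 0)) ∸ᴰ constant 2) (codeᴰ (var (# 1)) ∸ᴰ constant 2))

  copy-punctual : Punctual copy
  copy-punctual = toPrimRec copyᴰ

  -- The isomorphism onto T

  -- An unbounded search is harmless: only the isomorphism onto T uses it, and that need not be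
  -- primitive recursive.
  eventAt : ℕ → ℕ → ℕ
  eventAt c k = proj₁ (nth (event c) (event-infinite c) k)

  eventAt-event : ∀ c k → event c (eventAt c k) ≡ true
  eventAt-event c k = proj₁ (proj₂ (nth (event c) (event-infinite c) k))

  eventAt-number : ∀ c k → eventNumber c (eventAt c k) ≡ k
  eventAt-number c k = proj₂ (proj₂ (nth (event c) (event-infinite c) k))

  eventAt-unique : ∀ {c y} → event c y ≡ true → eventAt c (eventNumber c y) ≡ y
  eventAt-unique {c} {y} ev = count-injective (event c)
    (eventAt-event c (eventNumber c y)) ev (eventAt-number c (eventNumber c y))

  target : ℕ → ℕ
  target n = eventAt (code n) (number n)

  target-event : ∀ n → event (code n) (target n) ≡ true
  target-event n = eventAt-event (code n) (number n)

  target-number : ∀ n → eventNumber (code n) (target n) ≡ number n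
  target-number n = eventAt-number (code n) (number n)

  π : ℕ → ℕ
  π n = if code n <ᵇ 2 then member (code n) (target n) else code n ∸ 2

  -- As many events as `number n` precede the target. Hence elements with large numbers are matched
  -- late.
  number≤target : ∀ n → number n ≤ target n
  number≤target n = ≤-trans (≤-reflexive (sym (target-number n))) (count≤ _ _)

  π-speculative : ∀ {n} → code n < 2 → π n ≡ member (code n) (target n)
  π-speculative q rewrite <ᵇ-intro q = refl

  π-copied : ∀ {n} → 2 ≤ code n → π n ≡ code n ∸ 2
  π-copied q rewrite ≥⇒<ᵇ-false q = refl

  eventBefore-spec : ∀ n t → (target n < t → eventBefore n t ≡ target n) × (t ≤ target n → eventBefore n t ≡ t)
  eventBefore-spec n t = least-unique t (isEvent n) (target n)
    (∧-intro (target-event n) (≡ᵇ-intro (target-number n)))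
    (λ i q → let ev , num = ∧-true {event (code n) i} q in
      count-injective (event (code n)) ev (target-event n)
        (trans (≡ᵇ-true _ _ num) (sym (target-number n))))

  record Copied (n : ℕ) : Set where
    field
      ticks : tick n ≡ true
      isTooth : sawtooth (time n) ≡ code n
      isReady : ready (time n) (π n) ≡ true
      notMember : isMember (time n) (π n) ≡ false
      first : anyᵇ (time n) (offered (code n)) ≡ false

  code-copied : ∀ {n} → 2 ≤ code n →
                tick n ≡ true × code n ≡ sawtooth (time n) × accepted (time n) ≡ true
  code-copied {n} q with tick n | accepted (time n)
  ... | true | true = refl , refl , refl
  ... | true | false = ⊥-elim (<⇒≱ waiting<2 q)
  ... | false | _ = ⊥-elim (<⇒≱ waiting<2 q)

  copied : ∀ {n} → 2 ≤ code n → Copied n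
  copied {n} q = record
    { ticks = proj₁ facts
    ; isTooth = sym tooth
    ; isReady = subst (λ z → ready (time n) z ≡ true) z≡π (proj₁ (∧-true isFresh))
    ; notMember = subst (λ z → isMember (time n) z ≡ false) z≡π (not-true (proj₁ (∧-true rest)))
    ; first = not-true (proj₂ (∧-true {not (isMember (time n) (code n ∸ 2))} rest)) }
    where
    facts = code-copied q
    tooth = proj₁ (proj₂ facts)
    z≡π : code n ∸ 2 ≡ π n
    z≡π = sym (π-copied q)
    isFresh : fresh (code n) (time n) ≡ true
    isFresh with ∨-true {sawtooth (time n) <ᵇ 2} (proj₂ (proj₂ facts))
    ... | inj₁ r = ⊥-elim (<⇒≱ (subst (_< 2) (sym tooth) (<ᵇ-true _ _ r)) q)
    ... | inj₂ r = subst (λ k → fresh k (time n) ≡ true) (sym tooth) r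
    rest = proj₂ (∧-true {ready (time n) (code n ∸ 2)} isFresh)

  T-speculative : ∀ {n n′} → code n < 2 → code n′ < 2 →
    T (π n) (π n′) ≡ (number n ≡ᵇ number n′) ∧ compatible (code n) (code n′)
  T-speculative {n} {n′} q q′ rewrite π-speculative q | π-speculative q′ =
    trans (members q q′ (target-event n) (target-event n′))
      (cong₂ (λ i j → (i ≡ᵇ j) ∧ compatible (code n) (code n′))
        (target-number n) (target-number n′))

  copy≡T : ∀ n n′ → copy n n′ ≡ T (π n) (π n′)
  copy≡T n n′ with code n <? 2 | code n′ <? 2
  ... | yes q | yes q′ = trans (eq q q′) (sym (T-speculative q q′))
    where
    eq : code n < 2 → code n′ < 2 → copy n n′ ≡ (number n ≡ᵇ number n′) ∧ compatible (code n) (code n′)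
    eq q q′ rewrite <ᵇ-intro q | <ᵇ-intro q′ = refl
  ... | no q | no q′ rewrite ≥⇒<ᵇ-false (≮⇒≥ q) | ≥⇒<ᵇ-false (≮⇒≥ q′) = refl
  ... | yes q | no q′ with target n <? time n′
  ...   | yes r rewrite <ᵇ-intro q | ≥⇒<ᵇ-false (≮⇒≥ q′) | proj₁ (eventBefore-spec n (time n′)) r
                      | <ᵇ-intro r = refl
  -- The counterpart comes too late for n′, and T agrees with the default by readiness.
  ...   | no r = trans eq (sym (trans (cong (λ x → T x (π n′)) (π-speculative q))
                  (late-above (isReady (copied (≮⇒≥ q′))) (target-event n) (≮⇒≥ r))))
    where
    open Copied
    eq : copy n n′ ≡ false
    eq rewrite <ᵇ-intro q | ≥⇒<ᵇ-false (≮⇒≥ q′) | proj₂ (eventBefore-spec n (time n′)) (≮⇒≥ r)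
             | ≥⇒<ᵇ-false (≤-refl {time n′}) = refl
  copy≡T n n′ | no q | yes q′ with target n′ <? time n
  ...   | yes r rewrite <ᵇ-intro q′ | ≥⇒<ᵇ-false (≮⇒≥ q) | proj₁ (eventBefore-spec n′ (time n)) r
                      | <ᵇ-intro r = refl
  ...   | no r = trans eq (sym (trans (cong (T (π n)) (π-speculative q′))
                  (late-below (isReady (copied (≮⇒≥ q))) (target-event n′) (≮⇒≥ r))))
    where
    open Copied
    eq : copy n n′ ≡ T (π n) (anchor (code n′))
    eq rewrite <ᵇ-intro q′ | ≥⇒<ᵇ-false (≮⇒≥ q) | proj₂ (eventBefore-spec n′ (time n)) (≮⇒≥ r)
             | ≥⇒<ᵇ-false (≤-refl {time n}) = refl

  number-injective : ∀ {n n′} → code n ≡ code n′ → number n ≡ number n′ → n ≡ n′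
  number-injective {n} {n′} q r = count-injective (λ i → code i ≡ᵇ code n)
    (≡ᵇ-refl (code n)) (≡ᵇ-intro (sym q))
    (trans r (cong (λ c → count n′ (λ i → code i ≡ᵇ c)) (sym q)))

  compatible-antisym : ∀ {c c′} → compatible c c′ ≡ true → compatible c′ c ≡ true → c ≡ c′
  compatible-antisym {c} {c′} q q′ with ∨-true {c ≡ᵇ c′} q | ∨-true {c′ ≡ᵇ c} q′
  ... | inj₁ r | _ = ≡ᵇ-true c c′ r
  ... | inj₂ r | inj₁ r′ = sym (≡ᵇ-true c′ c r′)
  ... | inj₂ r | inj₂ r′ = ⊥-elim (<-asym (<ᵇ-true c c′ (proj₂ (∧-true {nested} r)))
                                          (<ᵇ-true c′ c (proj₂ (∧-true {nested} r′))))

  isMember-intro : ∀ {c y t z} → c < 2 → event c y ≡ true → y < t → z ≡ member c y → isMember t z ≡ true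
  isMember-intro {zero} {y} _ ev y<t eq = anyᵇ-intro _ y<t
    (∨-introˡ _ (∧-intro ev (≡ᵇ-intro (sym eq))))
  isMember-intro {suc zero} {y} {t} {z} _ ev y<t eq = anyᵇ-intro _ y<t
    (∨-introʳ (event 0 y ∧ (member 0 y ≡ᵇ z)) (∧-intro ev (≡ᵇ-intro (sym eq))))
  isMember-intro {suc (suc c)} (s≤s (s≤s ()))

  isMember-elim : ∀ {t z} → isMember t z ≡ true → Σ ℕ λ c → Σ ℕ λ y → c < 2 × event c y ≡ true × member c y ≡ z
  isMember-elim {t} {z} q with anyᵇ-true t _ q
  ... | y , _ , r with ∨-true {event 0 y ∧ (member 0 y ≡ᵇ z)} r
  ...   | inj₁ r′ = 0 , y , z<s , proj₁ (∧-true r′) , ≡ᵇ-true _ _ (proj₂ (∧-true {event 0 y} r′))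
  ...   | inj₂ r′ = 1 , y , s<s z<s , proj₁ (∧-true r′) , ≡ᵇ-true _ _ (proj₂ (∧-true {event 1 y} r′))

  -- A counterpart supplied before the node is copied is caught by `isMember`; one supplied later
  -- cannot be that node, as `late-above` would contradict reflexivity.
  copied≢speculative : ∀ {n n′} → 2 ≤ code n → code n′ < 2 → π n ≢ π n′
  copied≢speculative {n} {n′} q q′ eq with target n′ <? time n
  ... | yes r = true≢false (trans
    (sym (isMember-intro q′ (target-event n′) r (trans eq (π-speculative q′))))
    (Copied.notMember (copied q)))
  ... | no r = true≢false (trans (sym (T-refl (π n)))
    (trans (cong (λ x → T x (π n)) (trans eq (π-speculative q′)))
      (late-above (Copied.isReady (copied q)) (target-event n′) (≮⇒≥ r))))

  π-injective : ∀ {n n′} → π n ≡ π n′ → n ≡ n′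
  π-injective {n} {n′} eq with code n <? 2 | code n′ <? 2
  -- By reflexivity, equal images are related in both directions, which forces equal numbers and
  -- equal kinds.
  ... | yes q | yes q′ = number-injective
          (compatible-antisym (proj₂ (∧-true {number n ≡ᵇ number n′} fwd)) (proj₂ (∧-true {number n′ ≡ᵇ number n} bwd)))
          (≡ᵇ-true _ _ (proj₁ (∧-true fwd)))
    where
    fwd = trans (sym (T-speculative q q′)) (trans (cong (λ x → T x (π n′)) eq) (T-refl _))
    bwd = trans (sym (T-speculative q′ q)) (trans (cong (T (π n′)) eq) (T-refl _))
  ... | no q | yes q′ = ⊥-elim (copied≢speculative (≮⇒≥ q) q′ eq)
  ... | yes q | no q′ = ⊥-elim (copied≢speculative (≮⇒≥ q′) q (sym eq))
  ... | no q | no q′ = sameTime (<-cmp (time n) (time n′))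
    where
    codes : code n ≡ code n′
    codes = trans (sym (m∸n+n≡m (≮⇒≥ q)))
      (trans (cong (_+ 2) (trans (sym (π-copied (≮⇒≥ q))) (trans eq (π-copied (≮⇒≥ q′))))) (m∸n+n≡m (≮⇒≥ q′)))
    notBefore : ∀ {i j} → 2 ≤ code i → 2 ≤ code j → code i ≡ code j → ¬ (time i < time j)
    notBefore {i} {j} r r′ e lt = true≢false (trans (sym (anyᵇ-intro (offered (code j)) lt
      (∧-intro (≡ᵇ-intro (trans (Copied.isTooth (copied r)) e))
        (subst (λ z → ready (time i) z ≡ true) (trans (π-copied r) (cong (_∸ 2) e)) (Copied.isReady (copied r))))))
      (Copied.first (copied r′)))
    sameTime : _ → n ≡ n′
    sameTime (tri< lt _ _) = ⊥-elim (notBefore (≮⇒≥ q) (≮⇒≥ q′) codes lt)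
    sameTime (tri≈ _ e _) =
      count-injective tick (Copied.ticks (copied (≮⇒≥ q))) (Copied.ticks (copied (≮⇒≥ q′))) e
    sameTime (tri> _ _ gt) = ⊥-elim (notBefore (≮⇒≥ q′) (≮⇒≥ q) (sym codes) gt)

  atTime : ∀ t → accepted t ≡ true → Σ ℕ λ n → time n ≡ t × code n ≡ sawtooth t
  atTime t acc with nth tick tick-infinite t
  ... | n , ticks , refl = n , refl , eq
    where
    eq : code n ≡ sawtooth (time n)
    eq rewrite ticks | acc = refl

  code-infinite : ∀ c → c < 2 → ∀ N → Σ ℕ λ n → N ≤ n × (code n ≡ᵇ c) ≡ true
  code-infinite c c<2 N =
    let n , tn , cn = atTime t (∨-introˡ (fresh (sawtooth t) t) (<ᵇ-intro (subst (_< 2) (sym tooth) c<2)))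
    in n , ≤-trans N≤t (≤-trans (≤-reflexive (sym tn)) (count≤ n tick)) , ≡ᵇ-intro (trans cn tooth)
    where
    -- `suc N` because the value 1 occurs in the sawtooth only from block 1 on.
    t = suc N * suc N + c
    tooth : sawtooth t ≡ c
    tooth = sawtooth-spec (suc N) c (≤-trans (s≤s⁻¹ c<2) (m≤m+n 1 _))
    N≤t : N ≤ t
    N≤t = ≤-trans (n≤1+n N) (≤-trans (n≤n*n (suc N)) (m≤m+n _ c))

  withNumber : ∀ c → c < 2 → ∀ k → Σ ℕ λ n → code n ≡ c × number n ≡ k
  withNumber c c<2 k with nth (λ i → code i ≡ᵇ c) (code-infinite c c<2) k
  ... | n , q , r = n , ≡ᵇ-true _ _ q ,
    trans (cong (λ c → count n (λ i → code i ≡ᵇ c)) (≡ᵇ-true _ _ q)) r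

  π-surjective : ∀ x → Σ ℕ λ n → π n ≡ x
  π-surjective x
    with ready-eventually x
  ... | t₀ , rdy
    -- Block t₀ + (2 + x) starts no earlier than t₀ and is long enough to contain 2 + x. Of all
    -- offers the first is taken, since only it can be accepted.
    with least-exists (offered (2 + x)) ((t₀ + (2 + x)) * (t₀ + (2 + x)) + (2 + x))
      (∧-intro (≡ᵇ-intro (sawtooth-spec (t₀ + (2 + x)) (2 + x) (≤-trans (m≤n+m (2 + x) t₀) (m≤m+n _ _))))
        (rdy (≤-trans (m≤m+n t₀ (2 + x)) (≤-trans (n≤n*n (t₀ + (2 + x))) (m≤m+n _ (2 + x))))))
  ... | t , _ , off , earlier with isMember t x in mem
  ...   | true =
    let c , y , c<2 , ev , eq = isMember-elim {t} mem
        n , cn , kn = withNumber c c<2 (eventNumber c y)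
    in n , trans (π-speculative (subst (_< 2) (sym cn) c<2))
             (trans (cong₂ member cn (trans (cong₂ eventAt cn kn)
               (eventAt-unique ev))) eq)
  ...   | false =
    let n , _ , cn = atTime t acc
    in n , trans (π-copied (≤-trans (s≤s (s≤s z≤n)) (≤-reflexive (sym (trans cn tooth))))) (cong (_∸ 2) (trans cn tooth))
    where
    tooth : sawtooth t ≡ 2 + x
    tooth = ≡ᵇ-true _ _ (proj₁ (∧-true off))
    acc : accepted t ≡ true
    acc = ∨-introʳ (sawtooth t <ᵇ 2) (subst (λ r → fresh r t ≡ true) (sym tooth)
      (∧-intro (proj₂ (∧-true {sawtooth t ≡ᵇ 2 + x} off))
        (∧-intro (not-intro λ q → true≢false (trans (sym q) mem))
          (not-intro λ q → let i , i<t , oi = anyᵇ-true t _ q in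
            true≢false (trans (sym oi) (earlier i<t))))))

  ι : ℕ → ℕ
  ι x = proj₁ (π-surjective x)

  π-ι : ∀ x → π (ι x) ≡ x
  π-ι x = proj₂ (π-surjective x)

  lonely : ∀ {n n′} → code n < 2 → n′ < number n → T (π n′) (π n) ≡ true → T (π n′) (anchor (code n)) ≡ true
  lonely {n} {n′} q lt tr with code n′ <? 2
  -- The number of a speculative n′ is at most n′, and elements with different numbers are
  -- incomparable.
  ... | yes q′ = ⊥-elim (<⇒≢ (≤-<-trans (count≤ n′ _) lt)
                   (≡ᵇ-true _ _ (proj₁ (∧-true (trans (sym (T-speculative q′ q)) tr)))))
  ... | no q′ = trans (sym (late-below (Copied.isReady (copied (≮⇒≥ q′))) (target-event n)
                    (≤-trans (count≤ n′ tick) (≤-trans (<⇒≤ lt) (number≤target n)))))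
                  (trans (cong (T (π n′)) (sym (π-speculative q))) tr)

  speculativeCopy : SpeculativeCopy T S waiting tick
  speculativeCopy = record
    { copy = copy ; copy-punctual = copy-punctual ; π = π ; ι = ι ; π-ι = π-ι
    ; π-injective = π-injective ; copy≡T = copy≡T ; code = code
    ; code-idle = code-idle ; code-tick = code-tick
    ; target = target ; target-event = target-event ; π-speculative = π-speculative
    ; T-speculative = T-speculative ; lonely = lonely }
    where
    code-idle : ∀ {n} → tick n ≡ false → code n ≡ waiting
    code-idle q rewrite q = refl
    code-tick : ∀ {n} → tick n ≡ true → sawtooth (time n) < 2 → code n ≡ sawtooth (time n)
    code-tick q r rewrite q | <ᵇ-intro r = refl

-- The clock of a computation: it ticks for the x-th time once e has been seen to converge
-- at every argument up to x.

module Clock (e : Rec 1) (f : ℕ → ℕ) (evaluates : ∀ x → Eval e (x ∷ []) (f x)) where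
  open Definable noOracle
  open FuelDefinable noOracle

  -- The number of past ticks is also the argument under test; it is defined apart from `count`
  -- because `tick` refers to it.
  ticksBefore : ℕ → ℕ
  ticksBefore zero = 0
  ticksBefore (suc n) = ticksBefore n + b2n (0 <ᵇ fuel e n (ticksBefore n ∷ []))

  tick : ℕ → Bool
  tick n = 0 <ᵇ fuel e n (ticksBefore n ∷ [])

  count-tick : ∀ n → count n tick ≡ ticksBefore n
  count-tick zero = refl
  count-tick (suc n) = cong (_+ b2n (tick n)) (count-tick n)

  convergesᴰ : ∀ {n} {F G : Vec ℕ n → ℕ} → Def F → Def G → Defᵇ (λ xs → 0 <ᵇ fuel e (F xs) (G xs ∷ []))
  convergesᴰ a b = constant 0 <ᴰ comp₂ (fuelᴰ e) a b

  tickᴰ : Defᵇ {1} (λ v → tick (lookup v (# 0)))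
  tickᴰ = convergesᴰ (var (# 0))
    (comp₁ (recursion (λ v → ticksBefore (lookup v (# 0))) (constant 0)
      (var (# 1) +ᴰ numeric (convergesᴰ (var (# 0)) (var (# 1)))) (λ _ → refl) (λ _ _ → refl)) (var (# 0)))

  tick-infinite : ∀ N → Σ ℕ λ n → N ≤ n × tick n ≡ true
  tick-infinite N = search s N refl (m≤n+m s N)
    where
    converges = fuel-complete (evaluates (ticksBefore N))
    s = proj₁ converges
    -- Until a tick occurs the tested argument stays the same, so stage s at the latest has enough
    -- fuel.
    search : ∀ k n → ticksBefore n ≡ ticksBefore N → s ≤ n + k → Σ ℕ λ n′ → n ≤ n′ × tick n′ ≡ true
    search zero n same s≤n = n , ≤-refl , eq
      where
      eq : tick n ≡ true
      eq rewrite same | fuel-mono-suc e {xs = ticksBefore N ∷ []} (≤-trans s≤n (≤-reflexive (+-identityʳ n)))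
                          (proj₂ converges) = refl
    search (suc k) n same s≤n with tick n in ticks
    ... | true = n , ≤-refl , ticks
    ... | false =
      let n′ , n<n′ , t = search k (suc n) (trans next same) (≤-trans s≤n (≤-reflexive (+-suc n k)))
      in n′ , <⇒≤ n<n′ , t
      where
      next : ticksBefore (suc n) ≡ ticksBefore n
      next rewrite ticks = +-identityʳ _

  tickAt : ∀ x → Σ ℕ λ t → tick t ≡ true × count t tick ≡ x
  tickAt = nth tick tick-infinite

  fuel-read : ∀ {b} x → proj₁ (tickAt x) < b → pred (fuel e b (x ∷ [])) ≡ f x
  fuel-read {b} x t<b = cong pred
    (trans (fuel-mono-suc e (<⇒≤ t<b) (proj₂ converged)) (trans (sym (proj₂ converged)) value))
    where
    t = proj₁ (tickAt x)
    converged : Σ ℕ λ y → fuel e t (x ∷ []) ≡ suc y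
    converged with fuel e t (x ∷ []) in eq
    ... | suc y = y , refl
    ... | zero = ⊥-elim (true≢false (trans (sym (proj₁ (proj₂ (tickAt x))))
            (trans (cong (λ k → 0 <ᵇ fuel e t (k ∷ [])) (trans (sym (count-tick t)) (proj₂ (proj₂ (tickAt x)))))
              (cong (0 <ᵇ_) eq))))
    -- Completeness supplies some fuel with the true value, and by monotonicity two defined results
    -- agree.
    value : fuel e t (x ∷ []) ≡ suc (f x)
    value = let s , q = fuel-complete (evaluates x) in
      trans (proj₂ converged) (trans (sym (fuel-mono-suc e (m≤m⊔n t s) (proj₂ converged)))
        (fuel-mono-suc e (m≤n⊔m t s) q))

  module Horizon (next : ℕ → ℕ)
    (next-tick : ∀ s t → tick t ≡ true → count t tick ≤ count s tick → t ≤ next s) where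

    -- Each application of `next` passes one more tick, so x + 1 of them, from 0, pass the tick
    -- numbered x.
    horizon : ℕ → ℕ
    horizon zero = 0
    horizon (suc x) = suc (next (horizon x))

    horizon-ticks : ∀ x → x ≤ count (horizon x) tick
    tickAt<horizon : ∀ x → proj₁ (tickAt x) < horizon (suc x)

    tickAt<horizon x = let t , ticks , num = tickAt x in
      s≤s (next-tick (horizon x) t ticks (≤-trans (≤-reflexive num) (horizon-ticks x)))

    horizon-ticks zero = z≤n
    horizon-ticks (suc x) = let t , ticks , num = tickAt x in
      ≤-trans (s≤s (≤-reflexive (sym num))) (count-step {n = horizon (suc x)} tick (tickAt<horizon x) ticks)

  readOff : ∀ {d} next → Definable.Def d {1} (λ xs → next (lookup xs (# 0))) →
    (∀ s t → tick t ≡ true → count t tick ≤ count s tick → t ≤ next s) → f ≤PR d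
  readOff {d} next nextᴰ next-tick = D.toTerm {f}
    (D.ext (λ { (x ∷ []) → fuel-read x (tickAt<horizon x) })
      (D.predᴰ (D.comp₂ (FuelDefinable.fuelᴰ d e)
        (D.comp₁ horizonᴰ (D.sucᴰ (D.var (# 0)))) (D.var (# 0)))))
    where
    module D = Definable d
    open Horizon next next-tick
    horizonᴰ : D.Def {1} (λ xs → horizon (lookup xs (# 0)))
    horizonᴰ = D.recursion _ (D.constant 0) (D.sucᴰ (D.comp₁ nextᴰ (D.var (# 1)))) (λ _ → refl) (λ _ _ → refl)

-- Comparing the fast and the slow copy

module Extraction (T : Str) (T-refl : ∀ x → T x x ≡ true)
                  (T-punctual : Punctual T) (S : System T) (waiting : ℕ) (waiting<2 : waiting < 2)
                  (d : ℕ → ℕ) (categorical : InPrCat T d)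
                  (e : Rec 1) (f : ℕ → ℕ) (evaluates : ∀ x → Eval e (x ∷ []) (f x)) where
  open System S
  open Clock e f evaluates

  Tᴰ : Definable.Defᵇ noOracle {2} (λ v → T (lookup v (# 0)) (lookup v (# 1)))
  Tᴰ = fromPrimRec T-punctual

  always-infinite : ∀ N → Σ ℕ λ n → N ≤ n × true ≡ true
  always-infinite N = N , ≤-refl , refl

  abstract
    fast : SpeculativeCopy T S 0 (λ _ → true)
    fast = Copy.speculativeCopy T T-refl Tᴰ S 0 z<s (λ _ → true) (Definable.trueᴰ noOracle) always-infinite

    slow : SpeculativeCopy T S waiting tick
    slow = Copy.speculativeCopy T T-refl Tᴰ S waiting waiting<2 tick tickᴰ tick-infinite

  module Fast = SpeculativeCopy fast
  module Slow = SpeculativeCopy slow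

  fastIso = categorical Fast.copy Fast.copy-punctual Fast.isomorphic
  slowIso = categorical Slow.copy Slow.copy-punctual Slow.isomorphic

  f₀ g₀ f₁ g₁ : ℕ → ℕ
  f₀ = proj₁ fastIso
  g₀ = proj₁ (proj₂ fastIso)
  f₁ = proj₁ slowIso
  g₁ = proj₁ (proj₂ slowIso)

  isIso₀ : IsIso T Fast.copy f₀ g₀
  isIso₀ = proj₁ (proj₂ (proj₂ fastIso))

  isIso₁ : IsIso T Slow.copy f₁ g₁
  isIso₁ = proj₁ (proj₂ (proj₂ slowIso))

  -- One isomorphism is used forwards and the other backwards, so bounds on both directions enter.
  h : ℕ → ℕ
  h n = f₁ (g₀ n)

  ψ : ℕ → ℕ
  ψ n = Slow.π (h n)

  h-injective : ∀ {m n} → h m ≡ h n → m ≡ n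
  h-injective {m} {n} eq =
    trans (sym (right m)) (trans (cong f₀ (trans (sym (left (g₀ m))) (trans (cong g₁ eq) (left (g₀ n))))) (right n))
    where
    right = proj₁ (proj₂ isIso₀)
    left = proj₁ isIso₁

  T-ψ : ∀ m n → T (ψ m) (ψ n) ≡ T (Fast.π m) (Fast.π n)
  T-ψ m n = trans (sym (Slow.copy≡T (h m) (h n))) (trans (sym (proj₂ (proj₂ isIso₁) (g₀ m) (g₀ n)))
    (trans (proj₂ (proj₂ isIso₀) (g₀ m) (g₀ n))
      (trans (cong₂ Fast.copy (proj₁ (proj₂ isIso₀) m) (proj₁ (proj₂ isIso₀) n)) (Fast.copy≡T m n))))

  σ : ℕ → ℕ
  σ x = ψ (Fast.ι x)

  T-σ : ∀ x y → T (σ x) (σ y) ≡ T x y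
  T-σ x y = trans (T-ψ _ _) (cong₂ T (Fast.π-ι x) (Fast.π-ι y))

  ψ-σ : ∀ n → ψ n ≡ σ (Fast.π n)
  ψ-σ n = cong ψ (sym (Fast.π-injective (Fast.π-ι (Fast.π n))))

  σ-injective : ∀ {x y} → σ x ≡ σ y → x ≡ y
  σ-injective eq = trans (sym (Fast.π-ι _)) (trans (cong Fast.π (h-injective (Slow.π-injective eq))) (Fast.π-ι _))

  -- Among the 2 s + 1 images of witnesses below t, at most 2 s can lie below s or have a number below s.
  no-overflow : ∀ (w u : ℕ → ℕ) {s t} → (∀ {i j} → w i ≡ w j → i ≡ j) →
    (∀ i → T (Fast.π (u i)) (Fast.π (w i)) ≡ true) → (∀ i → u i ≢ w i) →
    (∀ i → T (ψ (u i)) (anchor waiting) ≡ false) →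
    (∀ {n} → s ≤ n → n < t → tick n ≡ false) →
    ¬ (∀ i → i ≤ s + s → h (w i) < t × h (u i) < t)
  no-overflow w u {s} {t} w-injective below distinct escapes idle inside =
    let i , j , i<j , eq = pigeonhole (n<1+n (s + s)) slot
    in <⇒≢ i<j (w-injective (h-injective (classes-injective (class i) (class j)
         (trans (sym (toℕ-fromℕ< (slot-bound (class i)))) (trans (cong toℕ eq) (toℕ-fromℕ< (slot-bound (class j))))))))
    where
    data Class (n : ℕ) : Set where
      early : n < s → Class n
      small : s ≤ n → n < t → Slow.number n < s → Class n
    index : ∀ {n} → Class n → ℕ
    index {n} (early _) = n
    index {n} (small _ _ _) = s + Slow.number n
    slot-bound : ∀ {n} (c : Class n) → index c < s + s
    slot-bound (early lt) = ≤-trans lt (m≤m+n s s)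
    slot-bound (small _ _ lt) = +-monoʳ-< s lt
    waits : ∀ {n} → s ≤ n → n < t → Slow.code n ≡ waiting
    waits s≤n n<t = Slow.code-idle (idle s≤n n<t)
    classes-injective : ∀ {m n} (a : Class m) (b : Class n) → index a ≡ index b → m ≡ n
    classes-injective (early _) (early _) eq = eq
    classes-injective (early lt) (small _ _ _) eq = ⊥-elim (<⇒≱ lt (≤-trans (m≤m+n s _) (≤-reflexive (sym eq))))
    classes-injective (small _ _ _) (early lt) eq = ⊥-elim (<⇒≱ lt (≤-trans (m≤m+n s _) (≤-reflexive eq)))
    classes-injective (small p q _) (small p′ q′ _) eq =
      Slow.number-injective (trans (waits p q) (sym (waits p′ q′))) (+-cancelˡ-≡ s _ _ eq)
    classify : ∀ i → h (w i) < t × h (u i) < t → Class (h (w i))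
    classify i (w<t , u<t) with h (w i) <? s | Slow.number (h (w i)) <? s
    ... | yes lt | _ = early lt
    ... | no ge | yes lt = small (≮⇒≥ ge) w<t lt
    -- The image of `w i` is a waiting element matched at s or later. If the image of `u i` comes
    -- before s, `lonely` puts it below the anchor; otherwise both have the waiting kind, and
    -- comparability makes them equal.
    ... | no ge | no ge′ = ⊥-elim (absurd (h (u i) <? s))
      where
      code-w : Slow.code (h (w i)) ≡ waiting
      code-w = waits (≮⇒≥ ge) w<t
      code-w<2 = subst (_< 2) (sym code-w) waiting<2
      order : T (ψ (u i)) (ψ (w i)) ≡ true
      order = trans (T-ψ (u i) (w i)) (below i)
      absurd : Dec (h (u i) < s) → ⊥
      absurd (yes lt) = true≢false (trans
        (sym (Slow.lonely code-w<2 (≤-trans lt (≮⇒≥ ge′)) order))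
        (trans (cong (λ c → T (ψ (u i)) (anchor c)) code-w) (escapes i)))
      absurd (no ge″) = distinct i (h-injective (Slow.number-injective (trans code-u (sym code-w))
        (≡ᵇ-true _ _ (proj₁ (∧-true (trans (sym (Slow.T-speculative
          (subst (_< 2) (sym code-u) waiting<2) code-w<2)) order))))))
        where
        code-u : Slow.code (h (u i)) ≡ waiting
        code-u = waits (≮⇒≥ ge″) u<t
    class : (i : Fin (suc (s + s))) → Class (h (w (toℕ i)))
    class i = classify (toℕ i) (inside (toℕ i) (s≤s⁻¹ (toℕ<n i)))
    slot : Fin (suc (s + s)) → Fin (s + s)
    slot i = fromℕ< (slot-bound (class i))

  module _ (u₀ : ℕ) where
    -- Exceeds the first 2 s + 1 witnesses of either kind, as many as `no-overflow` requires.
    base : ℕ → ℕ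
    base s = suc (s + s) * suc (s + s) + 2

    -- The square leaves room for the partner of a witness w, found below `suc w * suc w`; the
    -- summand leaves room for a single element `u₀` that is paired with all witnesses.
    range : ℕ → ℕ
    range s = base s * base s + u₀

    reach : ℕ → ℕ
    reach s = s ⊔ maxOver (range s) h

    module _ where
      open Definable d

      hᴰ : Def {1} (λ xs → h (lookup xs (# 0)))
      hᴰ = comp₁ (fromTerm (proj₁ (proj₂ (proj₂ (proj₂ slowIso)))))
                 (fromTerm (proj₂ (proj₂ (proj₂ (proj₂ fastIso)))))

      baseᴰ : ∀ {n} {F : Vec ℕ n → ℕ} → Def F → Def (λ xs → base (F xs))
      baseᴰ a = sucᴰ (a +ᴰ a) *ᴰ sucᴰ (a +ᴰ a) +ᴰ constant 2

      reachᴰ : Def {1} (λ xs → reach (lookup xs (# 0)))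
      reachᴰ = var (# 0) ⊔ᴰ maxOverᴰ (baseᴰ (var (# 0)) *ᴰ baseᴰ (var (# 0)) +ᴰ constant u₀)
                                     (comp₁ hᴰ (var (# 0)))

    -- Witnesses are found below range s, so that the image of range s under h reaches beyond
    -- the waiting period during which s is reached.
    computed : (w u : ℕ → ℕ) → (∀ {i j} → w i ≡ w j → i ≡ j) →
      (∀ i → T (Fast.π (u i)) (Fast.π (w i)) ≡ true) → (∀ i → u i ≢ w i) →
      (∀ i → T (ψ (u i)) (anchor waiting) ≡ false) →
      (∀ s i → i ≤ s + s → w i < range s × u i < range s) → f ≤PR d
    computed w u w-injective below distinct escapes inRange = readOff reach reachᴰ reach-tick
      where
      reach-tick : ∀ s t → tick t ≡ true → count t tick ≤ count s tick → t ≤ reach s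
      reach-tick s t ticks le = ≮⇒≥ λ lt → no-overflow w u {s} {t} w-injective below distinct escapes
        (λ {n} s≤n n<t → ¬true λ ticks′ →
          <⇒≱ (≤-<-trans (count-mono tick s≤n) (count-step tick n<t ticks′)) le)
        (λ i i≤2s → inside lt (proj₁ (inRange s i i≤2s)) , inside lt (proj₂ (inRange s i i≤2s)))
        where
        inside : ∀ {n} → reach s < t → n < range s → h n < t
        inside lt n<r = ≤-<-trans (≤-trans (maxOver-upper _ h n<r) (m≤n⊔m s _)) lt

  -- A stage where the sawtooth takes the value c; in the fast copy time and stage coincide. Block 0
  -- is skipped as it lacks the value 1.
  witness : ℕ → ℕ → ℕ
  witness c i = suc i * suc i + c

  count-always : ∀ n → count n (λ _ → true) ≡ n
  count-always zero = refl
  count-always (suc n) = trans (cong (_+ 1) (count-always n)) (+-comm n 1)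

  square-code : ∀ m c → c < 2 → c ≤ 2 * m → Fast.code (m * m + c) ≡ c
  square-code m c c<2 c≤2m = trans (Fast.code-tick refl (subst (_< 2) (sym tooth) c<2)) tooth
    where
    tooth : sawtooth (count (m * m + c) (λ _ → true)) ≡ c
    tooth = trans (cong sawtooth (count-always (m * m + c))) (sawtooth-spec m c c≤2m)

  witness-code : ∀ {c} i → c < 2 → Fast.code (witness c i) ≡ c
  witness-code {c} i c<2 = square-code (suc i) c c<2 (≤-trans (s≤s⁻¹ c<2) (m≤m+n 1 _))

  witness-injective : ∀ c {i j} → witness c i ≡ witness c j → i ≡ j
  witness-injective c {i} {j} eq with <-cmp i j
  ... | tri< lt _ _ = contradiction (+-cancelʳ-≡ c _ _ eq) (<⇒≢ (*-mono-< (s≤s lt) (s≤s lt)))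
  ... | tri≈ _ q _ = q
  ... | tri> _ _ gt = contradiction (+-cancelʳ-≡ c _ _ (sym eq)) (<⇒≢ (*-mono-< (s≤s gt) (s≤s gt)))

  witness<base : ∀ {c i} s → c < 2 → i ≤ s + s → witness c i < base 0 s
  witness<base {c} s c<2 i≤2s = ≤-trans (≤-reflexive (sym (+-suc _ c)))
    (+-mono-≤ (*-mono-≤ (s≤s i≤2s) (s≤s i≤2s)) c<2)

  witness-π : ∀ {c} i → c < 2 → Fast.π (witness c i) ≡ member c (Fast.target (witness c i))
  witness-π {c} i c<2 = trans (Fast.π-speculative (subst (_< 2) (sym (witness-code i c<2)) c<2))
    (cong (λ k → member k (Fast.target (witness c i))) (witness-code i c<2))

  coded-event : ∀ {c n} → Fast.code n ≡ c → event c (Fast.target n) ≡ true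
  coded-event {n = n} refl = Fast.target-event n

  -- All witnesses are paired with the element representing `anchor c`. Its image not being below
  -- the waiting anchor, it is not below a waiting element that is matched late. The kind c may be
  -- the waiting kind itself.
  computed-moved : ∀ c → c < 2 → T (σ (anchor c)) (anchor waiting) ≡ false → f ≤PR d
  computed-moved c c<2 moved = computed u₀ (witness c) (λ _ → u₀) (witness-injective c)
    below (λ i eq → true≢false (trans (sym (T-refl (anchor c)))
      (trans (cong (λ x → T x (anchor c)) (trans (sym (Fast.π-ι (anchor c))) (cong Fast.π eq))) (strict i))))
    (λ _ → moved)
    λ s i le → ≤-trans (witness<base s c<2 le) (≤-trans (n≤n*n _) (m≤m+n _ u₀)) , s≤s (m≤n+m u₀ _)
    where
    u₀ = Fast.ι (anchor c)
    below : ∀ i → T (Fast.π u₀) (Fast.π (witness c i)) ≡ true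
    below i = trans (cong₂ T (Fast.π-ι (anchor c)) (witness-π i c<2)) (anchor-below (coded-event (witness-code i c<2)))
    strict : ∀ i → T (Fast.π (witness c i)) (anchor c) ≡ false
    strict i = trans (cong (λ x → T x (anchor c)) (witness-π i c<2)) (anchor-strict (coded-event (witness-code i c<2)))

  -- Squares have kind 0; this bounds the search for the lower element with a given number.
  square-count : ∀ m → m ≤ count (m * m) (λ i → Fast.code i ≡ᵇ 0)
  square-count zero = z≤n
  square-count (suc m) = ≤-<-trans (square-count m)
    (count-step (λ i → Fast.code i ≡ᵇ 0) (*-mono-< (n<1+n m) (n<1+n m))
      (≡ᵇ-intro (trans (cong Fast.code (sym (+-identityʳ (m * m)))) (square-code m 0 z<s z≤n))))

  -- Serves when the anchor is not moved: each upper element is paired with the lower element of its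
  -- own pair, in place of the anchor.
  computed-nested : nested ≡ true → (∀ y → T (σ (member 0 y)) (anchor waiting) ≡ true → event 0 y ≡ true → ⊥) → f ≤PR d
  computed-nested nest fixed = computed 0 (witness 1) u (witness-injective 1)
    below distinct escapes
    λ s i le → ≤-trans (witness<base s (s<s z<s) le) (≤-trans (n≤n*n _) (m≤m+n _ 0)) ,
      ≤-trans (proj₁ (proj₂ (partner i)))
        (≤-trans (*-mono-≤ (witness<base s (s<s z<s) le) (witness<base s (s<s z<s) le)) (m≤m+n _ 0))
    where
    partner : ∀ i → Σ ℕ λ n → n < suc (witness 1 i) * suc (witness 1 i) ×
              (Fast.code n ≡ᵇ 0) ≡ true × count n (λ j → Fast.code j ≡ᵇ 0) ≡ Fast.number (witness 1 i)
    partner i = count-hit _ (λ j → Fast.code j ≡ᵇ 0) (Fast.number (witness 1 i))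
      (≤-trans (s≤s (count≤ (witness 1 i) _)) (square-count (suc (witness 1 i))))
    u : ℕ → ℕ
    u i = proj₁ (partner i)
    u-code : ∀ i → Fast.code (u i) ≡ 0
    u-code i = ≡ᵇ-true _ _ (proj₁ (proj₂ (proj₂ (partner i))))
    u-number : ∀ i → Fast.number (u i) ≡ Fast.number (witness 1 i)
    u-number i = trans (cong (λ c → count (u i) (λ j → Fast.code j ≡ᵇ c)) (u-code i)) (proj₂ (proj₂ (proj₂ (partner i))))
    below : ∀ i → T (Fast.π (u i)) (Fast.π (witness 1 i)) ≡ true
    below i = trans (Fast.T-speculative (subst (_< 2) (sym (u-code i)) z<s)
                       (subst (_< 2) (sym (witness-code i (s<s z<s))) (s<s z<s)))
      (∧-intro (≡ᵇ-intro (u-number i)) compatible₀₁)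
      where
      compatible₀₁ : compatible (Fast.code (u i)) (Fast.code (witness 1 i)) ≡ true
      compatible₀₁ rewrite u-code i | witness-code i (s<s z<s) | nest = refl
    distinct : ∀ i → u i ≢ witness 1 i
    distinct i eq = 0≢1+n (trans (sym (u-code i)) (trans (cong Fast.code eq) (witness-code i (s<s z<s))))
    escapes : ∀ i → T (ψ (u i)) (anchor waiting) ≡ false
    escapes i = ¬true λ q → fixed (Fast.target (u i))
      (trans (cong (λ x → T x (anchor waiting)) (trans (cong σ (sym u-π)) (sym (ψ-σ (u i))))) q)
      (coded-event (u-code i))
      where
      u-π : Fast.π (u i) ≡ member 0 (Fast.target (u i))
      u-π = trans (Fast.π-speculative (subst (_< 2) (sym (u-code i)) z<s))
        (cong (λ c → member c (Fast.target (u i))) (u-code i))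

-- Trees and their cones

listMax : List ℕ → ℕ
listMax [] = 0
listMax (x ∷ l) = x ⊔ listMax l

∈⇒≤listMax : ∀ {x l} → x ∈ l → x ≤ listMax l
∈⇒≤listMax {l = y ∷ l} (here refl) = m≤m⊔n y _
∈⇒≤listMax {l = y ∷ l} (there q) = ≤-trans (∈⇒≤listMax q) (m≤n⊔m y _)

module Tree (T : Str) (tree : IsTree T) where

  T-refl : ∀ x → T x x ≡ true
  T-refl = proj₁ (proj₁ tree)

  T-antisym : ∀ {x y} → T x y ≡ true → T y x ≡ true → x ≡ y
  T-antisym = proj₁ (proj₂ (proj₁ tree)) _ _

  T-trans : ∀ {x y z} → T x y ≡ true → T y z ≡ true → T x z ≡ true
  T-trans = proj₂ (proj₂ (proj₁ tree)) _ _ _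

  predecessors : ℕ → List ℕ
  predecessors x = proj₁ (proj₁ (proj₂ (proj₂ tree) x))

  predecessors-complete : ∀ {x y} → T y x ≡ true → y ≢ x → y ≤ listMax (predecessors x)
  predecessors-complete {x} {y} q r = ∈⇒≤listMax (proj₂ (proj₁ (proj₂ (proj₂ tree) x)) y (q , r))

  linear : ∀ {x y z} → T x z ≡ true → T y z ≡ true → T x y ≡ true ⊎ T y x ≡ true
  linear {x} {y} {z} q r with x ≟ z | y ≟ z
  ... | yes refl | _ = inj₂ r
  ... | no _ | yes refl = inj₁ q
  ... | no x≢z | no y≢z = proj₂ (proj₂ (proj₂ tree) z) x y (q , x≢z) (r , y≢z)

  over : ℕ → ℕ → Bool
  over p z = T p z ∧ not (p ≡ᵇ z)

  over-intro : ∀ {p z} → T p z ≡ true → p ≢ z → over p z ≡ true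
  over-intro q r = ∧-intro q (not-intro λ e → r (≡ᵇ-true _ _ e))

  over-≤ : ∀ {p z} → over p z ≡ true → T p z ≡ true
  over-≤ q = proj₁ (∧-true q)

  over-≢ : ∀ {p z} → over p z ≡ true → p ≢ z
  over-≢ {p} {z} q e = not-elim (proj₂ (∧-true {T p z} q)) (≡ᵇ-intro e)

  over-≱ : ∀ {p z} → over p z ≡ true → T z p ≡ false
  over-≱ q = ¬true λ r → over-≢ q (T-antisym (over-≤ q) r)

  over-trans : ∀ {p y z} → over p y ≡ true → T y z ≡ true → over p z ≡ true
  over-trans q r = over-intro (T-trans (over-≤ q) r)
    λ { refl → true≢false (trans (sym r) (over-≱ q)) }

  comparable : ℕ → ℕ → Bool
  comparable x y = T x y ∨ T y x

  comparable-sym : ∀ {x y} → comparable x y ≡ true → comparable y x ≡ true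
  comparable-sym {x} {y} q with ∨-true {T x y} q
  ... | inj₁ r = ∨-introʳ (T y x) r
  ... | inj₂ r = ∨-introˡ (T x y) r

  immSucc-over : ∀ {p x} → ImmSucc T p x → over p x ≡ true
  immSucc-over ((q , r) , _) = over-intro q r

  cone-over : ∀ {p x y} → ImmSucc T p x → T x y ≡ true → over p y ≡ true
  cone-over imm = over-trans (immSucc-over imm)

  -- If z ≤ y, then z and x are comparable as predecessors of y, and z cannot lie strictly between p
  -- and its immediate successor x.
  cone-comparable : ∀ {p x y z} → ImmSucc T p x → T x y ≡ true → over p z ≡ true →
                    comparable z y ≡ true → T x z ≡ true
  cone-comparable {p} {x} {y} {z} (_ , none) xy pz zy with ∨-true {T z y} zy
  ... | inj₂ yz = T-trans xy yz
  ... | inj₁ z≤y with linear xy z≤y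
  ...   | inj₁ xz = xz
  ...   | inj₂ zx with z ≟ x
  ...     | yes refl = T-refl z
  ...     | no z≢x = ⊥-elim (none (z , (over-≤ pz , over-≢ pz) , zx , z≢x))

  -- The successor is taken beyond N and beyond all predecessors of nodes numbered below N, so none
  -- of these nodes lies above it.
  late-cone : ∀ {p} → InfManyImmSucc T p → ∀ N →
              Σ ℕ λ x → ImmSucc T p x × (∀ {y} → T x y ≡ true → N ≤ y)
  late-cone inf N =
    let x , M<x , imm = inf M
    in x , imm , λ {y} xy → ≮⇒≥ λ y<N → late M<x xy y<N
    where
    M = N ⊔ suc (maxOver N (listMax ∘ predecessors))
    late : ∀ {x y} → M ≤ x → T x y ≡ true → y < N → ⊥
    late {x} {y} M≤x xy y<N with x ≟ y
    ... | yes refl = <⇒≱ y<N (≤-trans (m≤m⊔n N _) M≤x)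
    ... | no x≢y = <⇒≱ (≤-trans (m≤n⊔m N _) M≤x)
      (≤-trans (predecessors-complete xy x≢y) (maxOver-upper N (listMax ∘ predecessors) y<N))

  -- Otherwise the iterates of x would form chains of any length.
  no-descent : FiniteHeight T → ∀ (σ : ℕ → ℕ) → (∀ x y → T (σ x) (σ y) ≡ T x y) → ∀ x → T (σ x) x ≡ true → σ x ≡ x
  no-descent (height , bounded) σ order x down with σ x ≟ x
  ... | yes fixed = fixed
  ... | no moved = ⊥-elim (<⇒≱ (≤-reflexive (cong suc (sym (rest-length height)))) (bounded _ (chain height)))
    where
    iterate : ℕ → ℕ
    iterate zero = x
    iterate (suc n) = σ (iterate n)
    descends : ∀ n → T (iterate (suc n)) (iterate n) ≡ true × iterate (suc n) ≢ iterate n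
    descends zero = down , moved
    descends (suc n) = let q , r = descends n in trans (order _ _) q ,
      λ e → r (T-antisym q (trans (sym (order _ _)) (trans (cong (λ z → T z (σ (iterate (suc n)))) (sym e)) (T-refl _))))
    rest : ℕ → List ℕ
    rest zero = []
    rest (suc n) = iterate n ∷ rest n
    rest-length : ∀ n → length (rest n) ≡ n
    rest-length zero = refl
    rest-length (suc n) = cong suc (rest-length n)
    chain : ∀ n → Chain T (iterate n ∷ rest n)
    chain zero = cone x
    chain (suc n) = ccons _ _ _ (descends n) (chain n)

  module TreeDefinable (punctual : Punctual T) where
    open Definable noOracle

    Tᴰ : ∀ {n} {F G : Vec ℕ n → ℕ} → Def F → Def G → Defᵇ (λ xs → T (F xs) (G xs))
    Tᴰ = compᵇ₂ (fromPrimRec punctual)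

    overᴰ : ∀ {n} {F G : Vec ℕ n → ℕ} → Def F → Def G → Defᵇ (λ xs → over (F xs) (G xs))
    overᴰ a b = Tᴰ a b ∧ᴰ notᴰ (a ≡ᴰ b)

    comparableᴰ : ∀ {n} {F G : Vec ℕ n → ℕ} → Def F → Def G → Defᵇ (λ xs → comparable (F xs) (G xs))
    comparableᴰ a b = Tᴰ a b ∨ᴰ Tᴰ b a

-- Two infinitely branching nodes: lone elements above either of them

module TwoNodes (T : Str) (punctual : Punctual T) (tree : IsTree T)
                (a b : ℕ) (a≢b : a ≢ b) (inf-a : InfManyImmSucc T a) (inf-b : InfManyImmSucc T b) where
  open Tree T tree
  open TreeDefinable punctual
  open Definable noOracle

  anchor : ℕ → ℕ
  anchor c = if c ≡ᵇ 0 then a else b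

  -- Events come after both anchors, so that elements of different kinds are incomparable.
  event : ℕ → ℕ → Bool
  event c y = (a + b <ᵇ y) ∧ over (anchor c) y ∧ not (anyᵇ y λ z → over (anchor c) z ∧ comparable z y)

  event-late : ∀ {c y} → event c y ≡ true → ∀ c′ → anchor c′ < y
  event-late {c} {y} ev c′ = ≤-<-trans (anchor≤ c′) (<ᵇ-true (a + b) y (proj₁ (∧-true ev)))
    where
    anchor≤ : ∀ c → anchor c ≤ a + b
    anchor≤ zero = m≤m+n a b
    anchor≤ (suc c) = m≤n+m b a

  event-over : ∀ {c y} → event c y ≡ true → over (anchor c) y ≡ true
  event-over {c} {y} ev = proj₁ (∧-true (proj₂ (∧-true {a + b <ᵇ y} ev)))

  event-lone : ∀ {c y} → event c y ≡ true → ∀ {z} → z < y → over (anchor c) z ≡ true → comparable z y ≡ true → ⊥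
  event-lone {c} {y} ev z<y q r = not-elim
    (proj₂ (∧-true {over (anchor c) y} (proj₂ (∧-true {a + b <ᵇ y} ev))))
    (anyᵇ-intro (λ z → over (anchor c) z ∧ comparable z y) z<y (∧-intro q r))

  anchor-infinite : ∀ c → InfManyImmSucc T (anchor c)
  anchor-infinite zero = inf-a
  anchor-infinite (suc _) = inf-b

  -- The numerically first node of a late cone is an event: by `cone-comparable`, a node above the
  -- anchor and comparable to it is in the same cone.
  event-infinite : ∀ c N → Σ ℕ λ y → N ≤ y × event c y ≡ true
  event-infinite c N with late-cone (anchor-infinite c) (N ⊔ suc (a + b))
  ... | x , imm , late with least-exists (T x) x (T-refl x)
  ...   | y , _ , xy , minimal = y , ≤-trans (m≤m⊔n N _) (late xy) ,
    ∧-intro (<ᵇ-intro (≤-trans (m≤n⊔m N _) (late xy))) (∧-intro (cone-over imm xy)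
      (not-intro λ q → let z , z<y , r = anyᵇ-true y _ q in
        true≢false (trans (sym (cone-comparable imm xy (proj₁ (∧-true r)) (proj₂ (∧-true {over (anchor c) z} r))))
          (minimal z<y))))

  late-above : ∀ {z c y} → event c y ≡ true → z < y → T y z ≡ false
  late-above {z} {c} {y} ev z<y = ¬true λ yz →
    event-lone {c} {y} ev z<y (over-trans (event-over {c} {y} ev) yz) (∨-introʳ (T z y) yz)

  -- If z ≤ y, then z and the anchor are comparable, and a z strictly above the anchor would be an
  -- earlier node comparable to y.
  late-below : ∀ {z c y} → event c y ≡ true → z < y → T z y ≡ T z (anchor c)
  late-below {z} {c} {y} ev z<y = bool-ext down λ q → T-trans q (over-≤ (event-over {c} {y} ev))
    where
    down : T z y ≡ true → T z (anchor c) ≡ true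
    down zy with linear zy (over-≤ (event-over {c} {y} ev))
    ... | inj₁ q = q
    ... | inj₂ q with anchor c ≟ z
    ...   | yes e = subst (λ w → T z w ≡ true) (sym e) (T-refl z)
    ...   | no ne = ⊥-elim (event-lone {c} {y} ev z<y (over-intro q ne) (∨-introˡ (T y z) zy))

  -- Since events come after both anchors, `anchor c′` would be an earlier node above `anchor c`
  -- comparable to y.
  not-below-anchor : ∀ {c c′ y} → anchor c ≢ anchor c′ → event c y ≡ true → comparable (anchor c′) y ≡ true →
                     T (anchor c) (anchor c′) ≡ true → ⊥
  not-below-anchor {c} {c′} {y} ne ev cmp q = event-lone {c} {y} ev (event-late {c} {y} ev c′) (over-intro q ne) cmp

  separate : ∀ {c c′ y y′} → anchor c ≢ anchor c′ → event c y ≡ true → event c′ y′ ≡ true → T y y′ ≡ false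
  separate {c} {c′} {y} {y′} ne ev ev′ with <-cmp y y′
  ... | tri< lt _ _ = trans (late-below {c = c′} {y′} ev′ lt) (¬true λ q →
        not-below-anchor {c} {c′} {y} ne ev (∨-introʳ (T (anchor c′) y) q) (T-trans (over-≤ (event-over {c} {y} ev)) q))
  ... | tri> _ _ gt = late-above {c = c} {y} ev gt
  ... | tri≈ _ refl _ with linear (over-≤ (event-over {c} {y} ev)) (over-≤ (event-over {c′} {y} ev′))
  ...   | inj₁ q = ⊥-elim (not-below-anchor {c} {c′} {y} ne ev (∨-introˡ _ (over-≤ (event-over {c′} {y} ev′))) q)
  ...   | inj₂ q = ⊥-elim (not-below-anchor {c′} {c} {y} (ne ∘ sym) ev′ (∨-introˡ _ (over-≤ (event-over {c} {y} ev))) q)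

  members-same : ∀ c {y y′} → event c y ≡ true → event c y′ ≡ true →
                 T y y′ ≡ (count y (event c) ≡ᵇ count y′ (event c)) ∧ true
  members-same c {y} {y′} ev ev′ with <-cmp y y′
  ... | tri≈ _ refl _ rewrite ≡ᵇ-refl (count y (event c)) = T-refl y
  ... | tri< lt _ _ rewrite ≢⇒≡ᵇ-false (<⇒≢ (count-step (event c) lt ev)) =
        trans (late-below {c = c} {y′} ev′ lt) (over-≱ (event-over {c} {y} ev))
  ... | tri> _ _ gt rewrite ≢⇒≡ᵇ-false (<⇒≢ (count-step (event c) gt ev′) ∘ sym) = late-above {c = c} {y} ev gt

  members : ∀ {c c′ y y′} → c < 2 → c′ < 2 → event c y ≡ true → event c′ y′ ≡ true →
            T y y′ ≡ (count y (event c) ≡ᵇ count y′ (event c′)) ∧ ((c ≡ᵇ c′) ∨ false)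
  members {zero} {suc zero} {y} {y′} _ _ ev ev′ =
    trans (separate {0} {1} {y} {y′} a≢b ev ev′) (sym (∧-zeroʳ _))
  members {suc zero} {zero} {y} {y′} _ _ ev ev′ =
    trans (separate {1} {0} {y} {y′} (a≢b ∘ sym) ev ev′) (sym (∧-zeroʳ _))
  members {suc (suc _)} (s≤s (s≤s ()))
  members {c′ = suc (suc _)} _ (s≤s (s≤s ()))
  members {zero} {zero} {y} {y′} _ _ ev ev′ = members-same 0 {y} {y′} ev ev′
  members {suc zero} {suc zero} {y} {y′} _ _ ev ev′ = members-same 1 {y} {y′} ev ev′

  system : System T
  system = record
    { nested = false ; anchor = anchor ; event = event ; member = λ _ y → y ; ready = λ t z → z <ᵇ t
    ; anchorᴰ = anchorᴰ (var (# 0))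
    ; eventᴰ = constant (a + b) <ᴰ var (# 1) ∧ᴰ overᴰ (anchorᴰ (var (# 0))) (var (# 1))
        ∧ᴰ notᴰ (anyᴰ (var (# 1)) (overᴰ (anchorᴰ (var (# 1))) (var (# 0)) ∧ᴰ comparableᴰ (var (# 0)) (var (# 2))))
    ; memberᴰ = var (# 1)
    ; readyᴰ = var (# 1) <ᴰ var (# 0)
    ; event-infinite = event-infinite
    ; ready-eventually = λ z → suc z , <ᵇ-intro
    ; late-above = λ {t} {z} {c} {y} q ev t≤y → late-above {z} {c} {y} ev (≤-trans (<ᵇ-true z t q) t≤y)
    ; late-below = λ {t} {z} {c} {y} q ev t≤y → late-below {z} {c} {y} ev (≤-trans (<ᵇ-true z t q) t≤y)
    ; anchor-below = λ {c} {y} ev → over-≤ (event-over {c} {y} ev)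
    ; anchor-strict = λ {c} {y} ev → over-≱ (event-over {c} {y} ev)
    ; members = λ {c} {c′} → members {c} {c′} }
    where
    anchorᴰ : ∀ {n} {F : Vec ℕ n → ℕ} → Def F → Def (λ xs → anchor (F xs))
    anchorᴰ x = ifᴰ x ≡ᴰ constant 0 then constant a else constant b

-- One infinitely branching node: pairs above it

module OneNode (T : Str) (punctual : Punctual T) (tree : IsTree T)
               (a : ℕ) (inf-a : InfManyImmSucc T a)
               (successors : ∀ x → ImmSucc T a x → Σ ℕ λ y → ImmSucc T x y) where
  open Tree T tree
  open TreeDefinable punctual
  open Definable noOracle

  linked : ℕ → ℕ → Bool
  linked z w = over a w ∧ not (w ≡ᵇ z) ∧ comparable z w

  linked-intro : ∀ {z w} → over a w ≡ true → w ≢ z → comparable z w ≡ true → linked z w ≡ true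
  linked-intro {z} {w} p q r = ∧-intro {over a w} p (∧-intro (not-intro λ e → q (≡ᵇ-true w z e)) r)

  linked-over : ∀ {z w} → linked z w ≡ true → over a w ≡ true
  linked-over q = proj₁ (∧-true q)

  linked-comparable : ∀ {z w} → linked z w ≡ true → comparable z w ≡ true
  linked-comparable {z} {w} q = proj₂ (∧-true {not (w ≡ᵇ z)} (proj₂ (∧-true {over a w} q)))

  linked-sym : ∀ {z w} → over a z ≡ true → z ≢ w → linked z w ≡ true → linked w z ≡ true
  linked-sym {z} {w} p q r = linked-intro p q (comparable-sym {z} {w} (linked-comparable {z} {w} r))

  -- Either some node lies strictly between a and z, or z is an immediate successor of a and has a
  -- successor by hypothesis. The finite list of predecessors decides which.
  linked-exists : ∀ z → over a z ≡ true → Σ ℕ λ w → linked z w ≡ true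
  linked-exists z az with anyᵇ (suc (listMax (predecessors z))) (λ w → over a w ∧ over w z) in eq
  ... | true = let w , _ , r = anyᵇ-true (suc (listMax (predecessors z))) (λ w → over a w ∧ over w z) eq
                   aw = proj₁ (∧-true r)
                   wz = proj₂ (∧-true {over a w} r)
               in w , linked-intro aw (over-≢ wz) (∨-introʳ (T z w) (over-≤ wz))
  ... | false = let w , imm = successors z ((over-≤ az , over-≢ az) , none)
                    zw = immSucc-over imm
                in w , linked-intro (over-trans az (over-≤ zw)) (over-≢ zw ∘ sym) (∨-introˡ (T w z) (over-≤ zw))
    where
    none : ¬ Σ ℕ λ w → _<T_ T a w × _<T_ T w z
    none (w , (aw , a≢w) , (wz , w≢z)) = true≢false (trans
      (sym (∧-intro (over-intro aw a≢w) (over-intro wz w≢z)))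
      (anyᵇ-false (λ w → over a w ∧ over w z) eq (s≤s (predecessors-complete wz w≢z))))

  isolated : ℕ → ℕ → Bool
  isolated y z = not (anyᵇ y (linked z))

  -- y is the first element to be linked to some earlier elements, and is linked to no others.
  event : ℕ → Bool
  event y = over a y ∧ anyᵇ y (linked y) ∧ allᵇ y (λ z → not (linked y z) ∨ isolated y z)

  partner : ℕ → ℕ
  partner y = least y (linked y)

  lower : ℕ → ℕ
  lower y = if T (partner y) y then partner y else y

  upper : ℕ → ℕ
  upper y = if T (partner y) y then y else partner y

  memberOf : ℕ → ℕ → ℕ
  memberOf c y = if c ≡ᵇ 0 then lower y else upper y

  -- A node above a with no link so far may still become the partner in a pair, so it has to wait; a
  -- link among earlier nodes excludes it from all later pairs.
  ready : ℕ → ℕ → Bool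
  ready t z = (z <ᵇ t) ∧ (not (over a z) ∨ anyᵇ t (linked z))

  event-over : ∀ {y} → event y ≡ true → over a y ≡ true
  event-over q = proj₁ (∧-true q)

  partner-least : ∀ {y} → event y ≡ true → IsLeast y (linked y) (partner y)
  partner-least {y} q = least-spec y (linked y) (proj₁ (∧-true (proj₂ (∧-true {over a y} q))))

  event-isolated : ∀ {y z} → event y ≡ true → z < y → linked y z ≡ true → anyᵇ y (linked z) ≡ false
  event-isolated {y} {z} q z<y l with ∨-true {not (linked y z)}
    (allᵇ-true (λ z → not (linked y z) ∨ isolated y z)
      (proj₂ (∧-true {anyᵇ y (linked y)} (proj₂ (∧-true {over a y} q)))) z<y)
  ... | inj₁ r = ⊥-elim (not-elim r l)
  ... | inj₂ r = not-true r

  data IsMember (y : ℕ) : ℕ → Set where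
    self : IsMember y y
    other : IsMember y (partner y)

  memberOf-isMember : ∀ c y → IsMember y (memberOf c y)
  memberOf-isMember zero y with T (partner y) y
  ... | true = other
  ... | false = self
  memberOf-isMember (suc c) y with T (partner y) y
  ... | true = self
  ... | false = other

  isMember-over : ∀ {y x} → event y ≡ true → IsMember y x → over a x ≡ true
  isMember-over ev self = event-over ev
  isMember-over {y} ev other = linked-over {y} (IsLeast.holds (partner-least ev))

  -- Comparable to y, the node z would have to be isolated despite its link; comparable to the
  -- partner of y, it would itself be a link that the partner must not have.
  isMember-separate : ∀ {t z y x} → over a z ≡ true → ready t z ≡ true → event y ≡ true → t ≤ y →
                      IsMember y x → comparable x z ≡ true → ⊥
  isMember-separate {t} {z} {y} {x} az rdy ev t≤y = go
    where
    z<y : z < y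
    z<y = ≤-trans (<ᵇ-true z t (proj₁ (∧-true rdy))) t≤y
    link : anyᵇ y (linked z) ≡ true
    link with ∨-true {not (over a z)} (proj₂ (∧-true {z <ᵇ t} rdy))
    ... | inj₁ r = ⊥-elim (not-elim r az)
    ... | inj₂ r = let w , w<t , l = anyᵇ-true t (linked z) r in anyᵇ-intro (linked z) (≤-trans w<t t≤y) l
    open IsLeast (partner-least ev)
    partner-isolated = event-isolated ev bound holds
    go : IsMember y x → comparable x z ≡ true → ⊥
    go self cmp = true≢false (trans (sym link) (event-isolated ev z<y (linked-intro az (<⇒≢ z<y) cmp)))
    go other cmp = true≢false (trans (sym (anyᵇ-intro (linked (partner y)) z<y (linked-intro az z≢ cmp))) partner-isolated)
      where
      z≢ : z ≢ partner y
      z≢ e = true≢false (trans (sym link) (trans (cong (λ w → anyᵇ y (linked w)) e) partner-isolated))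

  late-above : ∀ {t z y x} → ready t z ≡ true → event y ≡ true → t ≤ y → IsMember y x → T x z ≡ false
  late-above {t} {z} {y} {x} rdy ev t≤y m = ¬true λ xz →
    isMember-separate (over-trans (isMember-over ev m) xz) rdy ev t≤y m (∨-introˡ (T z x) xz)

  late-below : ∀ {t z y x} → ready t z ≡ true → event y ≡ true → t ≤ y → IsMember y x → T z x ≡ T z a
  late-below {t} {z} {y} {x} rdy ev t≤y m = bool-ext down λ q → T-trans q (over-≤ (isMember-over ev m))
    where
    down : T z x ≡ true → T z a ≡ true
    down zx with linear zx (over-≤ (isMember-over ev m))
    ... | inj₁ q = q
    ... | inj₂ q with a ≟ z
    ...   | yes refl = T-refl a
    ...   | no a≢z = ⊥-elim (isMember-separate (over-intro q a≢z) rdy ev t≤y m (∨-introʳ (T x z) zx))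

  -- The members of a pair link each other. So for two different pairs the earlier one counts as
  -- ready nodes, and `late-above` and `late-below` give the relations.
  isMember-ready : ∀ {t y x} → event y ≡ true → y < t → IsMember y x → ready t x ≡ true
  isMember-ready {t} {y} ev y<t m = ∧-intro (<ᵇ-intro (early m)) (∨-introʳ (not (over a _)) (link m))
    where
    open IsLeast (partner-least ev)
    early : ∀ {x} → IsMember y x → x < t
    early self = y<t
    early other = <-trans bound y<t
    link : ∀ {x} → IsMember y x → anyᵇ t (linked x) ≡ true
    link self = anyᵇ-intro (linked y) (<-trans bound y<t) holds
    link other = anyᵇ-intro (linked (partner y)) y<t
      (linked-sym (event-over ev) (<⇒≢ bound ∘ sym) holds)

  lower-upper : ∀ {y} → event y ≡ true → T (lower y) (upper y) ≡ true × lower y ≢ upper y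
  lower-upper {y} ev with T (partner y) y in eq
  ... | true = eq , <⇒≢ bound
    where open IsLeast (partner-least ev)
  ... | false with ∨-true {T y (partner y)} (linked-comparable {y} (IsLeast.holds (partner-least ev)))
  ...   | inj₁ q = q , <⇒≢ (IsLeast.bound (partner-least ev)) ∘ sym
  ...   | inj₂ q = ⊥-elim (true≢false (trans (sym q) eq))

  compatible : ℕ → ℕ → Bool
  compatible c c′ = (c ≡ᵇ c′) ∨ (true ∧ (c <ᵇ c′))

  members-same : ∀ {c c′ y} → c < 2 → c′ < 2 → event y ≡ true → T (memberOf c y) (memberOf c′ y) ≡ compatible c c′
  members-same {zero} {zero} _ _ ev = T-refl _
  members-same {zero} {suc zero} _ _ ev = proj₁ (lower-upper ev)
  members-same {suc zero} {zero} {y} _ _ ev =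
    ¬true λ q → proj₂ (lower-upper ev) (T-antisym (proj₁ (lower-upper ev)) q)
  members-same {suc zero} {suc zero} _ _ ev = T-refl _
  members-same {suc (suc _)} (s≤s (s≤s ()))
  members-same {c′ = suc (suc _)} _ (s≤s (s≤s ()))

  members : ∀ {c c′ y y′} → c < 2 → c′ < 2 → event y ≡ true → event y′ ≡ true →
            T (memberOf c y) (memberOf c′ y′) ≡ (count y event ≡ᵇ count y′ event) ∧ compatible c c′
  members {c} {c′} {y} {y′} c<2 c′<2 ev ev′ with <-cmp y y′
  ... | tri≈ _ refl _ rewrite ≡ᵇ-refl (count y event) = members-same {c} {c′} c<2 c′<2 ev
  ... | tri< lt _ _ rewrite ≢⇒≡ᵇ-false (<⇒≢ (count-step event lt ev)) =
        trans (late-below (isMember-ready ev (n<1+n y) (memberOf-isMember c y)) ev′ lt (memberOf-isMember c′ y′))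
              (over-≱ (isMember-over ev (memberOf-isMember c y)))
  ... | tri> _ _ gt rewrite ≢⇒≡ᵇ-false (<⇒≢ (count-step event gt ev′) ∘ sym) =
        late-above (isMember-ready ev′ (n<1+n y′) (memberOf-isMember c′ y′)) ev gt (memberOf-isMember c y)

  module Cone {x} (imm : ImmSucc T a x) where

    joins : ℕ → Bool
    joins y = T x y ∧ anyᵇ y (λ z → T x z ∧ linked y z)

    joins-intro : ∀ {y z} → T x y ≡ true → T x z ≡ true → z < y → comparable y z ≡ true → joins y ≡ true
    joins-intro {y} {z} xy xz z<y cmp = ∧-intro xy (anyᵇ-intro (λ z → T x z ∧ linked y z) z<y
      (∧-intro xz (linked-intro (cone-over imm xz) (<⇒≢ z<y) cmp)))

    joins-exists : Σ ℕ λ y → joins y ≡ true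
    joins-exists with successors x imm
    ... | x′ , (xx′ , x≢x′) , _ with <-cmp x x′
    ...   | tri< lt _ _ = x′ , joins-intro xx′ (T-refl x) lt (∨-introʳ (T x′ x) xx′)
    ...   | tri≈ _ e _ = ⊥-elim (x≢x′ e)
    ...   | tri> _ _ gt = x , joins-intro (T-refl x) xx′ gt (∨-introˡ (T x′ x) xx′)

    -- A link between two nodes of the cone before y would have made the later of them a join
    -- already.
    least-join-event : ∀ {y} → joins y ≡ true → (∀ {i} → i < y → joins i ≡ false) → event y ≡ true
    least-join-event {y} join minimal with ∧-true {T x y} join
    ... | xy , rest = ∧-intro (cone-over imm xy) (∧-intro
      (let z , z<y , q = anyᵇ-true y _ rest in anyᵇ-intro (linked y) z<y (proj₂ (∧-true {T x z} q)))
      (allᵇ-intro y _ λ z z<y → alone z z<y (decide (linked y z))))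
      where
      noPair : ∀ {z w} → z < y → w < y → T x z ≡ true → T x w ≡ true → linked z w ≡ true → ⊥
      noPair {z} {w} z<y w<y xz xw l with <-cmp w z
      ... | tri< lt _ _ = true≢false (trans (sym (joins-intro xz xw lt (linked-comparable {z} {w} l))) (minimal z<y))
      ... | tri≈ _ e _ = not-elim (proj₁ (∧-true (proj₂ (∧-true {over a w} l)))) (≡ᵇ-intro e)
      ... | tri> _ _ gt = true≢false (trans
              (sym (joins-intro xw xz gt (comparable-sym {z} {w} (linked-comparable {z} {w} l)))) (minimal w<y))
      alone : ∀ z → z < y → linked y z ≡ true ⊎ linked y z ≡ false → not (linked y z) ∨ isolated y z ≡ true
      alone z z<y (inj₂ q) = ∨-introˡ (isolated y z) (cong not q)
      alone z z<y (inj₁ q) = ∨-introʳ (not (linked y z)) (not-intro λ r →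
        let w , w<y , l = anyᵇ-true y (linked z) r
            xz = cone-comparable imm xy (linked-over {y} q) (comparable-sym {y} {z} (linked-comparable {y} {z} q))
        in noPair z<y w<y xz
             (cone-comparable imm xz (linked-over {z} l) (comparable-sym {z} {w} (linked-comparable {z} {w} l))) l)

  event-infinite : ∀ N → Σ ℕ λ y → N ≤ y × event y ≡ true
  event-infinite N with late-cone inf-a N
  ... | x , imm , late with Cone.joins-exists imm
  ...   | y₀ , join₀ with least-exists (Cone.joins imm) y₀ join₀
  ...     | y , _ , join , minimal =
    y , late (proj₁ (∧-true join)) , Cone.least-join-event imm join minimal

  ready-eventually : ∀ z → Σ ℕ λ t → ∀ {t′} → t ≤ t′ → ready t′ z ≡ true
  ready-eventually z with decide (over a z)
  ... | inj₂ q = suc z , λ {t} le → ∧-intro (<ᵇ-intro le) (∨-introˡ (anyᵇ t (linked z)) (cong not q))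
  ... | inj₁ q with linked-exists z q
  ...   | w , l = suc (z ⊔ w) , λ le → ∧-intro (<ᵇ-intro (≤-trans (s≤s (m≤m⊔n z w)) le))
    (∨-introʳ (not (over a z)) (anyᵇ-intro (linked z) (≤-trans (s≤s (m≤n⊔m z w)) le) l))

  linkedᴰ : ∀ {n} {F G : Vec ℕ n → ℕ} → Def F → Def G → Defᵇ (λ xs → linked (F xs) (G xs))
  linkedᴰ z w = overᴰ (constant a) w ∧ᴰ notᴰ (w ≡ᴰ z) ∧ᴰ comparableᴰ z w

  anyLinkedᴰ : ∀ {n} {F G : Vec ℕ n → ℕ} → Def F → Def G → Defᵇ (λ xs → anyᵇ (F xs) (linked (G xs)))
  anyLinkedᴰ = compᵇ₂ (anyᴰ (var (# 0)) (linkedᴰ (var (# 2)) (var (# 0))))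

  eventᴰ : Defᵇ {2} (λ v → event (lookup v (# 1)))
  eventᴰ = overᴰ (constant a) (var (# 1)) ∧ᴰ anyLinkedᴰ (var (# 1)) (var (# 1))
    ∧ᴰ allᴰ (var (# 1)) (notᴰ (linkedᴰ (var (# 2)) (var (# 0))) ∨ᴰ notᴰ (anyLinkedᴰ (var (# 2)) (var (# 0))))

  partnerᴰ : Def {1} (λ v → partner (lookup v (# 0)))
  partnerᴰ = leastᴰ (var (# 0)) (linkedᴰ (var (# 1)) (var (# 0)))

  memberOfᴰ : Def {2} (λ v → memberOf (lookup v (# 0)) (lookup v (# 1)))
  memberOfᴰ = ifᴰ var (# 0) ≡ᴰ constant 0
    then (ifᴰ Tᴰ p (var (# 1)) then p else var (# 1))
    else (ifᴰ Tᴰ p (var (# 1)) then var (# 1) else p)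
    where p = comp₁ partnerᴰ (var {2} (# 1))

  system : System T
  system = record
    { nested = true ; anchor = λ _ → a ; event = λ _ → event ; member = memberOf ; ready = ready
    ; anchorᴰ = constant a
    ; eventᴰ = eventᴰ
    ; memberᴰ = memberOfᴰ
    ; readyᴰ = var (# 1) <ᴰ var (# 0) ∧ᴰ (notᴰ (overᴰ (constant a) (var (# 1))) ∨ᴰ anyLinkedᴰ (var (# 0)) (var (# 1)))
    ; event-infinite = λ _ → event-infinite
    ; ready-eventually = ready-eventually
    ; late-above = λ {c = c} {y} q ev t≤y → late-above q ev t≤y (memberOf-isMember c y)
    ; late-below = λ {c = c} {y} q ev t≤y → late-below q ev t≤y (memberOf-isMember c y)
    ; anchor-below = λ {c} {y} ev → over-≤ (isMember-over ev (memberOf-isMember c y))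
    ; anchor-strict = λ {c} {y} ev → over-≱ (isMember-over ev (memberOf-isMember c y))
    ; members = λ {c} {c′} → members {c} {c′} }

-- The choice of the waiting kind in the two cases

module TwoNodesCone (T : Str) (punctual : Punctual T) (tree : IsTree T) (height : FiniteHeight T)
  (a b : ℕ) (a≢b : a ≢ b) (inf-a : InfManyImmSucc T a) (inf-b : InfManyImmSucc T b)
  (d : ℕ → ℕ) (categorical : InPrCat T d) (e : Rec 1) (f : ℕ → ℕ)
  (evaluates : ∀ x → Eval e (x ∷ []) (f x)) where
  open Tree T tree

  system : System T
  system = TwoNodes.system T punctual tree a b a≢b inf-a inf-b

  module E₀ = Extraction T T-refl punctual system 0 z<s d categorical e f evaluates
  module E₁ = Extraction T T-refl punctual system 1 (s<s z<s) d categorical e f evaluates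

  -- σ₁ (σ₀ b) ≤ σ₁ a ≤ b, and an automorphism moves no node down; hence σ₁ a = b = σ₁ b.
  not-all-below : T (E₀.σ b) a ≡ true → T (E₁.σ a) b ≡ true → T (E₁.σ b) b ≡ true → ⊥
  not-all-below σ₀b≤a σ₁a≤b σ₁b≤b =
    a≢b (E₁.σ-injective (trans (T-antisym σ₁a≤b b≤σ₁a) (sym (no-descent height E₁.σ E₁.T-σ b σ₁b≤b))))
    where
    τb≤σ₁a : T (E₁.σ (E₀.σ b)) (E₁.σ a) ≡ true
    τb≤σ₁a = trans (E₁.T-σ (E₀.σ b) a) σ₀b≤a
    τb≡b : E₁.σ (E₀.σ b) ≡ b
    τb≡b = no-descent height (λ x → E₁.σ (E₀.σ x))
      (λ x y → trans (E₁.T-σ (E₀.σ x) (E₀.σ y)) (E₀.T-σ x y)) b (T-trans τb≤σ₁a σ₁a≤b)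
    b≤σ₁a : T b (E₁.σ a) ≡ true
    b≤σ₁a = subst (λ x → T x (E₁.σ a) ≡ true) τb≡b τb≤σ₁a

  -- The comparisons involve two automorphisms, one for each waiting kind; any that fails names a
  -- waiting kind and a kind of witnesses that work.
  computable≤d : f ≤PR d
  computable≤d with decide (T (E₀.σ b) a) | decide (T (E₁.σ a) b) | decide (T (E₁.σ b) b)
  ... | inj₂ q | _ | _ = E₀.computed-moved 1 (s<s z<s) q
  ... | inj₁ _ | inj₂ q | _ = E₁.computed-moved 0 z<s q
  ... | inj₁ _ | inj₁ _ | inj₂ q = E₁.computed-moved 1 (s<s z<s) q
  ... | inj₁ p | inj₁ q | inj₁ r = ⊥-elim (not-all-below p q r)

module OneNodeCone (T : Str) (punctual : Punctual T) (tree : IsTree T) (height : FiniteHeight T)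
  (a : ℕ) (inf-a : InfManyImmSucc T a) (successors : ∀ x → ImmSucc T a x → Σ ℕ λ y → ImmSucc T x y)
  (d : ℕ → ℕ) (categorical : InPrCat T d) (e : Rec 1) (f : ℕ → ℕ)
  (evaluates : ∀ x → Eval e (x ∷ []) (f x)) where
  open Tree T tree

  system : System T
  system = OneNode.system T punctual tree a inf-a successors

  module E = Extraction T T-refl punctual system 0 z<s d categorical e f evaluates

  -- If σ a is not below a, then a itself escapes. Otherwise σ fixes a and keeps lower elements
  -- strictly above it, so the pairs serve.
  computable≤d : f ≤PR d
  computable≤d with decide (T (E.σ a) a)
  ... | inj₂ q = E.computed-moved 0 z<s q
  ... | inj₁ q = E.computed-nested refl λ y le ev → true≢false (trans
    (sym (trans (sym (E.T-σ (member 0 y) a)) (trans (cong (T (E.σ (member 0 y))) (no-descent height E.σ E.T-σ a q)) le)))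
    (anchor-strict {0} {y} ev))
    where open System system

theorem5p2 : (T : Str) → Punctual T → IsTree T → FiniteHeight T →
    Condition1 T ⊎ Condition2 T →
    (d : ℕ → ℕ) → InPrCat T d → InConeΔ01 d
theorem5p2 T punctual tree height (inj₁ (a , b , a≢b , inf-a , inf-b)) d categorical f (e , evaluates) =
  TwoNodesCone.computable≤d T punctual tree height a b a≢b inf-a inf-b d categorical e f evaluates
theorem5p2 T punctual tree height (inj₂ (a , inf-a , _ , successors)) d categorical f (e , evaluates) =
  OneNodeCone.computable≤d T punctual tree height a inf-a successors d categorical e f evaluates
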